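{- Let $G=(V,E)$ be a finite undirected (simple) graph, let $k\ge 1$, and let $A_1,\dots,A_k$ be finite abelian groups with cardinalities $|A_i|=t_i$. Then \begin{align*}\mathrm{Flow}^k_G(A_1,\dots,A_k)&=(-1)^{k|E|}\sum_{(B_i)\in\mathcal{C}^k_E}\ \prod_{i=1}^k(-1)^{|B_i|}t_i^{|B_i|-\mathrm{rk}(B_i)}\\&=(-1)^{k(|E|+\mathrm{rk}(G))}\,T^k_{M(G)}(0,\dots,0;\,1-t_1,\dots,1-t_k).\end{align*}
   Context: Graph notation: for $B\subseteq E$, $c(B)$ is the number of connected components of $(V,B)$, $\mathrm{rk}(B)=|V|-c(B)$, $\mathrm{rk}(G)=\mathrm{rk}(E)$, and $M(G)=(E,\mathrm{rk})$ is the graphic matroid. $\mathcal{C}^k_E=\{(B_1,\dots,B_k)\mid B_1\subseteq\cdots\subseteq B_k\subseteq E\}$ (inclusions need not be strict). Coupled multicommodity flows: fix an orientation $G'=(V,E')$ of $G$ ($E'\subseteq V\times V$ contains exactly one of $(a,b),(b,a)$ for each edge $\{a,b\}\in E$). Groups are written additively. A $k$-tuple $(f_1,\dots,f_k)$ of functions $f_i:E'\to A_i$ is a coupled $k$-multicommodity flow on $G'$ if each $f_i$ satisfies Kirchhoff's first law, $\sum_{j:(v,j)\in E'}f_i(v,j)=\sum_{j:(j,v)\in E'}f_i(j,v)$ for all $v\in V$, and for every $e\in E'$: (i) for every even index $2m$ with $2\le 2m\le k$: if $f_i(e)=0$ for all odd $i$ with $1\le i\le 2m-1$, then $f_{2m}(e)=0$;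 and (ii) if $k$ is odd: if $f_i(e)=0$ for all odd $i$ with $1\le i\le k-2$, then $f_k(e)\neq 0$ (for $k=1$ this reads: $f_1(e)\ne0$ for all $e$, i.e. $f_1$ is a nowhere zero flow). $\mathrm{Flow}^k_G(A_1,\dots,A_k)$ is the number of coupled $k$-multicommodity flows on $G'$ with groups $A_1,\dots,A_k$; this number does not depend on the chosen orientation $G'$. For a matroid $M=(\mathcal{A},\mathrm{rk})$ with $\mathrm{rk}(M)=\mathrm{rk}(\mathcal{A})$, the $k$th chain Tutte polynomial is $T^k_M(x_1,\dots,x_k;y_1,\dots,y_k)=\sum_{S_1\subseteq\cdots\subseteq S_k\subseteq\mathcal{A}}\ \prod_{i=1}^k(x_i-1)^{\mathrm{rk}(M)-\mathrm{rk}(S_i)}(y_i-1)^{|S_i|-\mathrm{rk}(S_i)}$. -}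

module Defs where

open import Level using (Level; 0ℓ; _⊔_) renaming (suc to lsuc)
open import Algebra.Bundles using (AbelianGroup)
import Algebra.Definitions.RawMonoid as RawMonoidOps
open import Data.Bool using (if_then_else_)
open import Data.Fin using (Fin; zero; suc; toℕ; punchIn; punchOut; combine; remQuot)
  renaming (_<_ to _<ᶠ_)
open import Data.Fin.Properties
  using (all?; _≟_; injective⇒≤; punchInᵢ≢i; punchOut-punchIn; punchIn-punchOut; punchOut-cong; combine-remQuot; remQuot-combine)
open import Data.Fin.Subset using (Subset; inside; outside; _∈_; _⊆_; _∪_; _∩_; ∣_∣; ⊤)
open import Data.Fin.Subset.Properties
  using (_⊆?_; x∈p∪q⁻; x∈p∩q⁻)
open import Data.Integer using (ℤ; +_; 0ℤ; 1ℤ; -1ℤ) renaming (_+_ to _+ℤ_; _*_ to _*ℤ_; _-_ to _-ℤ_; _^_ to _^ℤ_)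
import Data.Integer.Properties as ℤₚ
open import Data.List using (List; []; _∷_; [_]; _++_; map; foldr; filter; length; cartesianProductWith)
open import Data.List.Membership.Propositional using () renaming (_∈_ to _∈ˡ_)
open import Data.List.Membership.Propositional.Properties using (∈-map⁺; ∈-map⁻; ∈-++⁺ˡ; ∈-++⁺ʳ; ∈-++⁻)
open import Data.List.Properties using (length-map)
open import Data.List.Relation.Unary.Any using (here; there)
open import Data.Nat using (ℕ; zero; suc; _+_; _∸_; _≤_; _<_; _≤?_; _<?_; z≤n; s≤s)
import Data.Nat as ℕ
open import Data.Nat.Divisibility using (_∣_; _∤_; _∣?_)
import Data.Nat.Properties as ℕₚ
open import Data.Product using (Σ; ∃; _×_; _,_; proj₁; proj₂; swap)
open import Data.Sum using (_⊎_; inj₁; inj₂)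
open import Data.Vec using (Vec; []; _∷_; lookup)
open import Data.Vec.Base using (here; there)
open import Data.Vec.Relation.Unary.Linked using (Linked; linked?)
open import Function using (_∘_; _on_)
open import Function.Bundles using (Inverse)
open import Relation.Binary using (Rel; Setoid; _⇒_)
import Relation.Binary.Construct.Closure.Equivalence as Eq
open import Relation.Binary.Construct.Closure.Equivalence using (EqClosure)
open import Relation.Binary.Construct.Closure.ReflexiveTransitive using (ε; _◅_; _◅◅_)
open import Relation.Binary.Construct.Closure.Symmetric using (fwd; bwd)
open import Relation.Binary.PropositionalEquality
  using (_≡_; _≢_; refl; sym; trans; cong; cong₂; subst) renaming (setoid to ≡-setoid)
open import Relation.Nullary using (¬_; Dec; yes; no; contradiction; ¬?; does)
open import Relation.Nullary.Decidable using (map′; _×-dec_; _→-dec_)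

------------------------------------------------------------------------
-- Cardinality of finite setoids

HasCardinality : ∀ {a ℓ} → Setoid a ℓ → ℕ → Set (a ⊔ ℓ)
HasCardinality S n = Inverse S (≡-setoid (Fin n))

Finite : ∀ {a ℓ} → Setoid a ℓ → Set (a ⊔ ℓ)
Finite S = ∃ λ n → HasCardinality S n

card : ∀ {a ℓ} {S : Setoid a ℓ} → Finite S → ℕ
card = proj₁

module _ {a ℓ} (S : Setoid a ℓ) where
  open Setoid S renaming (refl to ≈-refl; sym to ≈-sym; trans to ≈-trans)

  mkCardinality : ∀ {n} (to : Carrier → Fin n) (from : Fin n → Carrier) →
                  (∀ {x y} → x ≈ y → to x ≡ to y) →
                  (∀ i → to (from i) ≡ i) → (∀ x → from (to x) ≈ x) →
                  HasCardinality S n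
  mkCardinality to from to-cong to∘from from∘to = record
    { to        = to
    ; from      = from
    ; to-cong   = to-cong
    ; from-cong = λ { refl → ≈-refl }
    ; inverse   = (λ {x} p → trans (to-cong p) (to∘from x)) , (λ { {x} refl → from∘to x })
    }

  subsetoid : ∀ {p} → (Carrier → Set p) → Setoid (a ⊔ p) ℓ
  subsetoid P = record
    { Carrier       = Σ Carrier P
    ; _≈_           = _≈_ on proj₁
    ; isEquivalence = record { refl = ≈-refl ; sym = ≈-sym ; trans = ≈-trans }
    }

Π-setoid : ∀ {n a ℓ} → (Fin n → Setoid a ℓ) → Setoid a ℓ
Π-setoid S = record
  { Carrier       = ∀ i → Setoid.Carrier (S i)
  ; _≈_           = λ f g → ∀ i → Setoid._≈_ (S i) (f i) (g i)
  ; isEquivalence = record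
    { refl  = λ i → Setoid.refl (S i)
    ; sym   = λ p i → Setoid.sym (S i) (p i)
    ; trans = λ p q i → Setoid.trans (S i) (p i) (q i)
    }
  }

Finite⇒≈? : ∀ {a ℓ} {S : Setoid a ℓ} → Finite S → ∀ x y → Dec (Setoid._≈_ S x y)
Finite⇒≈? {S = S} (_ , I) x y =
  map′ (λ p → S.trans (S.sym (inverseʳ refl)) (inverseʳ p)) to-cong (to x ≟ to y)
  where
  open Inverse I
  module S = Setoid S

Π-finite : ∀ {n a ℓ} (S : Fin n → Setoid a ℓ) → (∀ i → Finite (S i)) → Finite (Π-setoid S)
Π-finite {zero}  S fin = 1 , mkCardinality (Π-setoid S)
  (λ _ → zero) (λ _ ()) (λ _ → refl) (λ { zero → refl ; (suc ()) }) (λ _ ())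
Π-finite {suc n} S fin = p ℕ.* q , mkCardinality (Π-setoid S) to from to-cong to∘from from∘to
  where
  p = proj₁ (fin zero)
  rest = Π-finite (S ∘ suc) (fin ∘ suc)
  q = proj₁ rest
  module I = Inverse (proj₂ (fin zero))
  module J = Inverse (proj₂ rest)

  to : Setoid.Carrier (Π-setoid S) → Fin (p ℕ.* q)
  to f = combine (I.to (f zero)) (J.to (f ∘ suc))

  from : Fin (p ℕ.* q) → Setoid.Carrier (Π-setoid S)
  from x zero    = I.from (proj₁ (remQuot {p} q x))
  from x (suc i) = J.from (proj₂ (remQuot {p} q x)) i

  to-cong : ∀ {f g} → Setoid._≈_ (Π-setoid S) f g → to f ≡ to g
  to-cong f≈g = cong₂ combine (I.to-cong (f≈g zero)) (J.to-cong (f≈g ∘ suc))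

  to∘from : ∀ x → to (from x) ≡ x
  to∘from x = trans (cong₂ combine (I.inverseˡ (Setoid.refl (S zero))) (J.inverseˡ (λ i → Setoid.refl (S (suc i)))))
                    (combine-remQuot {p} q x)

  from∘to : ∀ f → Setoid._≈_ (Π-setoid S) (from (to f)) f
  from∘to f zero    = I.inverseʳ (cong proj₁ (remQuot-combine (I.to (f zero)) (J.to (f ∘ suc))))
  from∘to f (suc i) = J.inverseʳ (cong proj₂ (remQuot-combine (I.to (f zero)) (J.to (f ∘ suc)))) i

Fin-sub-finite : ∀ {n p} (Q : Fin n → Set p) → (∀ i → Dec (Q i)) → Finite (subsetoid (≡-setoid (Fin n)) Q)
Fin-sub-finite {zero}  Q Q? = 0 , mkCardinality (subsetoid (≡-setoid (Fin 0)) Q)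
  (λ { (() , _) }) (λ ()) (λ { {() , _} }) (λ ()) (λ { (() , _) })
Fin-sub-finite {suc n} Q Q? with Fin-sub-finite (Q ∘ suc) (Q? ∘ suc) | Q? zero
... | c , I | yes q₀ = suc c , mkCardinality (subsetoid (≡-setoid (Fin (suc n))) Q) to from to-cong to∘from from∘to
  where
  module I = Inverse I
  to : Σ (Fin (suc n)) Q → Fin (suc c)
  to (zero  , _) = zero
  to (suc i , q) = suc (I.to (i , q))
  from : Fin (suc c) → Σ (Fin (suc n)) Q
  from zero    = zero , q₀
  from (suc j) = suc (proj₁ (I.from j)) , proj₂ (I.from j)
  to-cong : ∀ {x y} → proj₁ x ≡ proj₁ y → to x ≡ to y
  to-cong {zero  , _} refl = refl
  to-cong {suc _ , _} refl = cong suc (I.to-cong refl)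
  to∘from : ∀ j → to (from j) ≡ j
  to∘from zero    = refl
  to∘from (suc j) = cong suc (I.inverseˡ refl)
  from∘to : ∀ x → proj₁ (from (to x)) ≡ proj₁ x
  from∘to (zero  , _) = refl
  from∘to (suc _ , _) = cong suc (I.inverseʳ refl)
... | c , I | no ¬q₀ = c , mkCardinality (subsetoid (≡-setoid (Fin (suc n))) Q) to from to-cong to∘from from∘to
  where
  module I = Inverse I
  to : Σ (Fin (suc n)) Q → Fin c
  to (zero  , q) = contradiction q ¬q₀
  to (suc i , q) = I.to (i , q)
  from : Fin c → Σ (Fin (suc n)) Q
  from j = suc (proj₁ (I.from j)) , proj₂ (I.from j)
  to-cong : ∀ {x y} → proj₁ x ≡ proj₁ y → to x ≡ to y
  to-cong {zero  , q} refl = contradiction q ¬q₀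
  to-cong {suc _ , _} refl = I.to-cong refl
  to∘from : ∀ j → to (from j) ≡ j
  to∘from j = I.inverseˡ refl
  from∘to : ∀ x → proj₁ (from (to x)) ≡ proj₁ x
  from∘to (zero  , q) = contradiction q ¬q₀
  from∘to (suc _ , _) = cong suc (I.inverseʳ refl)

subsetoid-finite : ∀ {a ℓ p} {S : Setoid a ℓ} (P : Setoid.Carrier S → Set p) → (∀ x → Dec (P x)) →
                   (∀ {x y} → Setoid._≈_ S x y → P x → P y) →
                   Finite S → Finite (subsetoid S P)
subsetoid-finite {S = S} P P? resp (n , I) = proj₁ sub , mkCardinality (subsetoid S P)
  (λ { (x , p) → J.to (I.to x , resp (S.sym (I.inverseʳ refl)) p) })
  (λ j → I.from (proj₁ (J.from j)) , proj₂ (J.from j))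
  (λ x≈y → J.to-cong (I.to-cong x≈y))
  (λ j → J.inverseˡ (I.inverseˡ S.refl))
  (λ { (x , p) → I.inverseʳ (J.inverseʳ refl) })
  where
  module S = Setoid S
  module I = Inverse I
  sub = Fin-sub-finite (P ∘ I.from) (P? ∘ I.from)
  module J = Inverse (proj₂ sub)

------------------------------------------------------------------------
-- Finite sums and products, and chains of subsets

∑ : ∀ {a} {X : Set a} → List X → (X → ℤ) → ℤ
∑ xs φ = foldr (λ x s → φ x +ℤ s) 0ℤ xs

∏ : ∀ {k} → (Fin k → ℤ) → ℤ
∏ = RawMonoidOps.sum ℤₚ.*-1-rawMonoid

-- All vectors with entries from xs; free of repetitions if xs is.
vectors : ∀ {a} {X : Set a} → List X → ∀ n → List (Vec X n)
vectors xs zero    = [ [] ]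
vectors xs (suc n) = cartesianProductWith _∷_ xs (vectors xs n)

subsets : ∀ m → List (Subset m)
subsets = vectors (outside ∷ inside ∷ [])

-- Linked _⊆_ (B₁ ∷ ⋯ ∷ Bₖ) says B₁ ⊆ ⋯ ⊆ Bₖ.
chains : ∀ k m → List (Vec (Subset m) k)
chains k m = filter (linked? _⊆?_) (vectors (subsets m) k)

------------------------------------------------------------------------
-- Matroids (by their rank function) and the chain Tutte polynomial

record Matroid (m : ℕ) : Set where
  field
    rk          : Subset m → ℕ
    rk-bounded  : ∀ S → rk S ≤ ∣ S ∣
    rk-monotone : ∀ {S T} → S ⊆ T → rk S ≤ rk T
    submodular  : ∀ S T → rk (S ∪ T) + rk (S ∩ T) ≤ rk S + rk T

  rank : ℕ
  rank = rk ⊤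

-- The value of the polynomial at integer points.  Neither exponent is
-- truncated by ∸, because rk is monotone and bounded by the cardinality.
chainTutte : ∀ {m} → Matroid m → (k : ℕ) → (x y : Fin k → ℤ) → ℤ
chainTutte {m} M k x y = ∑ (chains k m) λ S → ∏ λ i →
  (x i -ℤ 1ℤ) ^ℤ (rank ∸ rk (lookup S i)) *ℤ (y i -ℤ 1ℤ) ^ℤ (∣ lookup S i ∣ ∸ rk (lookup S i))
  where open Matroid M

------------------------------------------------------------------------
-- Graphs

-- A finite simple graph on the vertex set Fin #V.  The edge {a , b} is
-- recorded as the pair listing its ends in increasing order, so there are
-- no loops, and injectivity excludes parallel edges.
record Graph : Set where
  field
    #V #E          : ℕ
    ends           : Fin #E → Fin #V × Fin #V
    ends-ordered   : ∀ e → proj₁ (ends e) <ᶠ proj₂ (ends e)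
    ends-injective : ∀ {e e′} → ends e ≡ ends e′ → e ≡ e′

-- An orientation E′, indexed by E: arc e is the pair that E′ contains
-- among (a , b) and (b , a), for e = {a , b}.
record Orientation (G : Graph) : Set where
  open Graph G
  field
    arc          : Fin #E → Fin #V × Fin #V
    arc-orients  : ∀ e → arc e ≡ ends e ⊎ arc e ≡ swap (ends e)

  tail head : Fin #E → Fin #V
  tail = proj₁ ∘ arc
  head = proj₂ ∘ arc

-- Connectedness is computed for lists of edges first, by merging classes
-- edge by edge.

module _ {n : ℕ} {R : Rel (Fin n) 0ℓ} where

  sound⇒closed : ∀ {a} {A : Set a} (f : Fin n → A) → (∀ {u v} → R u v → f u ≡ f v) →
                 ∀ {u v} → EqClosure R u v → f u ≡ f v
  sound⇒closed f f-sound ε           = refl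
  sound⇒closed f f-sound (fwd r ◅ s) = trans (f-sound r) (sound⇒closed f f-sound s)
  sound⇒closed f f-sound (bwd r ◅ s) = trans (sym (f-sound r)) (sound⇒closed f f-sound s)

  mkComponents : ∀ {c} (cls : Fin n → Fin c) (rep : Fin c → Fin n) →
                 (∀ {u v} → R u v → cls u ≡ cls v) →
                 (∀ i → cls (rep i) ≡ i) → (∀ v → EqClosure R (rep (cls v)) v) →
                 HasCardinality (Eq.setoid R) c
  mkComponents cls rep cls-sound = mkCardinality (Eq.setoid R) cls rep (sound⇒closed cls cls-sound)

EqClosure-mono : ∀ {n} {R R′ : Rel (Fin n) 0ℓ} → R ⇒ R′ → EqClosure R ⇒ EqClosure R′
EqClosure-mono = Eq.map

module ListConnectivity {n m : ℕ} (ends : Fin m → Fin n × Fin n) where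

  AdjacentL : List (Fin m) → Rel (Fin n) 0ℓ
  AdjacentL L u v = ∃ λ e → e ∈ˡ L × ends e ≡ (u , v)

  AdjacentL-mono : ∀ {L M} → (∀ {e} → e ∈ˡ L → e ∈ˡ M) → AdjacentL L ⇒ AdjacentL M
  AdjacentL-mono L⊆M (e , e∈L , eq) = e , L⊆M e∈L , eq

  module Merge {c : ℕ} (α β : Fin (suc c)) (α≢β : α ≢ β) where

    merge : Fin (suc c) → Fin c
    merge x with α ≟ x
    ... | yes _   = punchOut α≢β
    ... | no  α≢x = punchOut α≢x

    merge-α : merge α ≡ punchOut α≢β
    merge-α with α ≟ α
    ... | yes _   = refl
    ... | no  α≢α = contradiction refl α≢α

    merge-other : ∀ {x} (α≢x : α ≢ x) → merge x ≡ punchOut α≢x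
    merge-other {x} α≢x with α ≟ x
    ... | yes α≡x = contradiction α≡x α≢x
    ... | no  _   = punchOut-cong α refl

  componentsL-finite : ∀ L → Finite (Eq.setoid (AdjacentL L))

  mergeEdge : ∀ e L {c} (I : HasCardinality (Eq.setoid (AdjacentL L)) c) →
              let cls = Inverse.to I ; a = proj₁ (ends e) ; b = proj₂ (ends e) in
              Dec (cls a ≡ cls b) → Finite (Eq.setoid (AdjacentL (e ∷ L)))

  componentsL-finite []      = n , mkComponents (λ v → v) (λ v → v) (λ { (_ , () , _) }) (λ _ → refl) (λ _ → ε)
  componentsL-finite (e ∷ L) =
    let c , I = componentsL-finite L in mergeEdge e L I (Inverse.to I (proj₁ (ends e)) ≟ Inverse.to I (proj₂ (ends e)))

  mergeEdge e L {c} I (yes α≡β) = c , mkComponents I.to I.from to-sound (λ i → I.inverseˡ ε)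
    (λ v → EqClosure-mono (AdjacentL-mono there) (I.inverseʳ refl))
    where
    module I = Inverse I
    to-sound : ∀ {u v} → AdjacentL (e ∷ L) u v → I.to u ≡ I.to v
    to-sound (_ , here refl , refl) = α≡β
    to-sound (_ , there e∈L , eq)   = I.to-cong (fwd (_ , e∈L , eq) ◅ ε)
  mergeEdge e L {zero}  I (no _)    with () ← Inverse.to I (proj₁ (ends e))
  mergeEdge e L {suc c} I (no α≢β) = c , mkComponents (merge ∘ I.to) (I.from ∘ punchIn α) to-sound to∘from from∘to
    where
    module I = Inverse I
    a = proj₁ (ends e)
    b = proj₂ (ends e)
    α = I.to a
    β = I.to b
    open Merge α β α≢β
    weaken : ∀ {u v} → EqClosure (AdjacentL L) u v → EqClosure (AdjacentL (e ∷ L)) u v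
    weaken = EqClosure-mono (AdjacentL-mono there)
    to-sound : ∀ {u v} → AdjacentL (e ∷ L) u v → merge (I.to u) ≡ merge (I.to v)
    to-sound (_ , here refl , refl) = trans merge-α (sym (merge-other α≢β))
    to-sound (_ , there e∈L , eq)   = cong merge (I.to-cong (fwd (_ , e∈L , eq) ◅ ε))
    to∘from : ∀ i → merge (I.to (I.from (punchIn α i))) ≡ i
    to∘from i = trans (cong merge (I.inverseˡ ε))
                      (trans (merge-other (punchInᵢ≢i α i ∘ sym)) (punchOut-punchIn α))
    from∘to : ∀ v → EqClosure (AdjacentL (e ∷ L)) (I.from (punchIn α (merge (I.to v)))) v
    from∘to v with α ≟ I.to v
    ... | yes α≡v = weaken (I.inverseʳ (punchIn-punchOut α≢β)) ◅◅ (bwd (e , here refl , refl) ◅ ε)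
                    ◅◅ weaken (Eq.symmetric _ (I.inverseʳ refl) ◅◅ I.inverseʳ α≡v)
    ... | no  α≢v = weaken (I.inverseʳ (punchIn-punchOut α≢v))

  cL : List (Fin m) → ℕ
  cL L = card (componentsL-finite L)

  clsL : ∀ L → Fin n → Fin (cL L)
  clsL L = Inverse.to (proj₂ (componentsL-finite L))

  -- Does adding the edge leave the components as they are?
  data Step (e : Fin m) (L : List (Fin m)) : Set where
    same   : EqClosure (AdjacentL L) (proj₁ (ends e)) (proj₂ (ends e)) → cL (e ∷ L) ≡ cL L → Step e L
    merged : ¬ EqClosure (AdjacentL L) (proj₁ (ends e)) (proj₂ (ends e)) → suc (cL (e ∷ L)) ≡ cL L → Step e L

  step : ∀ e L → Step e L
  step e L = aux (componentsL-finite L) (clsL L (proj₁ (ends e)) ≟ clsL L (proj₂ (ends e))) refl refl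
    where
    aux : ∀ (F : Finite (Eq.setoid (AdjacentL L)))
          (d : Dec (Inverse.to (proj₂ F) (proj₁ (ends e)) ≡ Inverse.to (proj₂ F) (proj₂ (ends e)))) →
          cL L ≡ proj₁ F → cL (e ∷ L) ≡ proj₁ (mergeEdge e L (proj₂ F) d) → Step e L
    aux (c     , I) (yes p) eq eq′ =
      same (Eq.symmetric _ (Inverse.inverseʳ I refl) ◅◅ Inverse.inverseʳ I p) (trans eq′ (sym eq))
    aux (zero  , I) (no _)  eq eq′ with () ← Inverse.to I (proj₁ (ends e))
    aux (suc c , I) (no ¬p) eq eq′ = merged (¬p ∘ Inverse.to-cong I) (trans (cong suc eq′) (sym eq))

  components-antitone : ∀ {R R′ : Rel (Fin n) 0ℓ} {c c′} → R ⇒ R′ →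
    HasCardinality (Eq.setoid R) c → HasCardinality (Eq.setoid R′) c′ → c′ ≤ c
  components-antitone R⇒R′ I J = injective⇒≤ {f = I.to ∘ J.from} λ {i} {j} eq →
    trans (sym (J.inverseˡ ε)) (J.inverseˡ
      (EqClosure-mono R⇒R′ (Eq.symmetric _ (I.inverseʳ refl) ◅◅ I.inverseʳ eq)))
    where
    module I = Inverse I
    module J = Inverse J

  cL-antitone : ∀ {L M} → (∀ {e} → e ∈ˡ L → e ∈ˡ M) → cL M ≤ cL L
  cL-antitone L⊆M = components-antitone (AdjacentL-mono L⊆M) (proj₂ (componentsL-finite _)) (proj₂ (componentsL-finite _))

  cL≤n : ∀ L → cL L ≤ n
  cL≤n L = components-antitone {AdjacentL []} (λ { (_ , () , _) }) (proj₂ (componentsL-finite [])) (proj₂ (componentsL-finite L))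

  n≤cL+length : ∀ L → n ≤ cL L + length L
  n≤cL+length []      = ℕₚ.m≤m+n n 0
  n≤cL+length (e ∷ L) with step e L
  ... | same   _ eq = ℕₚ.≤-trans (n≤cL+length L) (ℕₚ.+-mono-≤ (ℕₚ.≤-reflexive (sym eq)) (ℕₚ.n≤1+n _))
  ... | merged _ eq = ℕₚ.≤-trans (n≤cL+length L) (ℕₚ.≤-reflexive
        (trans (cong (_+ length L) (sym eq)) (sym (ℕₚ.+-suc (cL (e ∷ L)) (length L)))))

  cL-supermodular : ∀ {M N} → (∀ {e} → e ∈ˡ M → e ∈ˡ N) → ∀ L →
                    cL (L ++ M) + cL N ≤ cL (L ++ N) + cL M
  cL-supermodular {M} {N} M⊆N []      = ℕₚ.≤-reflexive (ℕₚ.+-comm (cL M) (cL N))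
  cL-supermodular {M} {N} M⊆N (e ∷ L) = combineSteps (step e (L ++ M)) (step e (L ++ N))
    where
    ih : cL (L ++ M) + cL N ≤ cL (L ++ N) + cL M
    ih = cL-supermodular M⊆N L

    L++M⊆L++N : ∀ {e} → e ∈ˡ L ++ M → e ∈ˡ L ++ N
    L++M⊆L++N x with ∈-++⁻ L x
    ... | inj₁ y = ∈-++⁺ˡ y
    ... | inj₂ y = ∈-++⁺ʳ L (M⊆N y)

    both-same : ∀ {x x′ y y′ p q} → x′ ≡ x → y′ ≡ y → x + p ≤ y + q → x′ + p ≤ y′ + q
    both-same refl refl le = le

    left-merged : ∀ {x x′ y y′ p q} → suc x′ ≡ x → y′ ≡ y → x + p ≤ y + q → x′ + p ≤ y′ + q
    left-merged refl refl le = ℕₚ.≤-trans (ℕₚ.n≤1+n _) le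

    both-merged : ∀ {x x′ y y′ p q} → suc x′ ≡ x → suc y′ ≡ y → x + p ≤ y + q → x′ + p ≤ y′ + q
    both-merged refl refl le = ℕₚ.≤-pred le

    combineSteps : Step e (L ++ M) → Step e (L ++ N) → cL (e ∷ L ++ M) + cL N ≤ cL (e ∷ L ++ N) + cL M
    combineSteps (same _ p)   (same _ q)    = both-same p q ih
    combineSteps (merged _ p) (same _ q)    = left-merged p q ih
    combineSteps (merged _ p) (merged _ q)  = both-merged p q ih
    combineSteps (same a p)   (merged ¬a q) = contradiction (EqClosure-mono (AdjacentL-mono L++M⊆L++N) a) ¬a

elements : ∀ {m} → Subset m → List (Fin m)
elements []            = []
elements (inside  ∷ p) = zero ∷ map suc (elements p)
elements (outside ∷ p) = map suc (elements p)

length-elements : ∀ {m} (p : Subset m) → length (elements p) ≡ ∣ p ∣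
length-elements []            = refl
length-elements (inside  ∷ p) = cong suc (trans (length-map suc (elements p)) (length-elements p))
length-elements (outside ∷ p) = trans (length-map suc (elements p)) (length-elements p)

∈-elements⁺ : ∀ {m} {p : Subset m} {e} → e ∈ p → e ∈ˡ elements p
∈-elements⁺ {p = inside  ∷ p} here      = here refl
∈-elements⁺ {p = inside  ∷ p} (there x) = there (∈-map⁺ suc (∈-elements⁺ x))
∈-elements⁺ {p = outside ∷ p} (there x) = ∈-map⁺ suc (∈-elements⁺ x)

∈-elements⁻ : ∀ {m} {p : Subset m} {e} → e ∈ˡ elements p → e ∈ p
∈-elements⁻ {p = inside  ∷ p} (here refl) = here
∈-elements⁻ {p = inside  ∷ p} (there x) with _ , y , refl ← ∈-map⁻ suc x = there (∈-elements⁻ y)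
∈-elements⁻ {p = outside ∷ p} x         with _ , y , refl ← ∈-map⁻ suc x = there (∈-elements⁻ y)

module _ (G : Graph) where
  open Graph G
  open ListConnectivity ends

  Adjacent : Subset #E → Rel (Fin #V) 0ℓ
  Adjacent B u v = ∃ λ e → e ∈ B × ends e ≡ (u , v)

  -- Vertices of (V , B), equal when some walk in (V , B) joins them.
  components : Subset #E → Setoid 0ℓ 0ℓ
  components B = Eq.setoid (Adjacent B)

  components-finite : ∀ B → Finite (components B)
  components-finite B = proj₁ F , mkComponents I.to I.from
    (λ { (e , e∈B , eq) → I.to-cong (fwd (e , ∈-elements⁺ e∈B , eq) ◅ ε) })
    (λ i → I.inverseˡ ε)
    (λ v → EqClosure-mono (λ { (e , e∈B , eq) → e , ∈-elements⁻ e∈B , eq }) (I.inverseʳ refl))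
    where
    F = componentsL-finite (elements B)
    module I = Inverse (proj₂ F)

  #components : Subset #E → ℕ
  #components B = card (components-finite B)

  graphRk : Subset #E → ℕ
  graphRk B = #V ∸ #components B

  graphRank : ℕ
  graphRank = graphRk ⊤

  graphRk-submodular : ∀ S T → graphRk (S ∪ T) + graphRk (S ∩ T) ≤ graphRk S + graphRk T
  graphRk-submodular S T = complement
    (cL≤n (elements (S ∪ T))) (cL≤n (elements (S ∩ T))) (cL≤n (elements S)) (cL≤n (elements T)) supermodular
    where
    LS = elements S
    LT = elements T
    LI = elements (S ∩ T)

    LI⊆LT : ∀ {e} → e ∈ˡ LI → e ∈ˡ LT
    LI⊆LT x = ∈-elements⁺ (proj₂ (x∈p∩q⁻ S T (∈-elements⁻ x)))

    LS++LI⊆LS : ∀ {e} → e ∈ˡ LS ++ LI → e ∈ˡ LS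
    LS++LI⊆LS x with ∈-++⁻ LS x
    ... | inj₁ y = y
    ... | inj₂ y = ∈-elements⁺ (proj₁ (x∈p∩q⁻ S T (∈-elements⁻ y)))

    ∪⊆LS++LT : ∀ {e} → e ∈ˡ elements (S ∪ T) → e ∈ˡ LS ++ LT
    ∪⊆LS++LT x with x∈p∪q⁻ S T (∈-elements⁻ x)
    ... | inj₁ y = ∈-++⁺ˡ (∈-elements⁺ y)
    ... | inj₂ y = ∈-++⁺ʳ LS (∈-elements⁺ y)

    supermodular : cL LS + cL LT ≤ cL (elements (S ∪ T)) + cL LI
    supermodular = ℕₚ.≤-trans (ℕₚ.+-monoˡ-≤ (cL LT) (cL-antitone LS++LI⊆LS))
      (ℕₚ.≤-trans (cL-supermodular LI⊆LT LS) (ℕₚ.+-monoˡ-≤ (cL LI) (cL-antitone ∪⊆LS++LT)))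

    complement : ∀ {n u i s t} → u ≤ n → i ≤ n → s ≤ n → t ≤ n → s + t ≤ u + i →
                 (n ∸ u) + (n ∸ i) ≤ (n ∸ s) + (n ∸ t)
    complement {n} {u} {i} {s} {t} u≤n i≤n s≤n t≤n le = ℕₚ.+-cancelˡ-≤ (s + t) _ _ (begin
      (s + t) + ((n ∸ u) + (n ∸ i)) ≤⟨ ℕₚ.+-monoˡ-≤ _ le ⟩
      (u + i) + ((n ∸ u) + (n ∸ i)) ≡⟨ total u≤n i≤n ⟩
      n + n                         ≡⟨ total s≤n t≤n ⟨
      (s + t) + ((n ∸ s) + (n ∸ t)) ∎)
      where
      open ℕₚ.≤-Reasoning
      total : ∀ {a b} → a ≤ n → b ≤ n → (a + b) + ((n ∸ a) + (n ∸ b)) ≡ n + n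
      total {a} {b} a≤n b≤n = trans (ℕₚ.+-assoc a b _)
        (trans (cong (λ z → a + z) (trans (sym (ℕₚ.+-assoc b (n ∸ a) (n ∸ b)))
          (trans (cong (_+ (n ∸ b)) (ℕₚ.+-comm b (n ∸ a)))
          (trans (ℕₚ.+-assoc (n ∸ a) b (n ∸ b)) (cong (λ z → (n ∸ a) + z) (ℕₚ.m+[n∸m]≡n b≤n))))))
        (trans (sym (ℕₚ.+-assoc a (n ∸ a) n)) (cong (_+ n) (ℕₚ.m+[n∸m]≡n a≤n))))

  graphicMatroid : Matroid #E
  graphicMatroid = record
    { rk          = graphRk
    ; rk-bounded  = λ S → subst (graphRk S ≤_) (length-elements S)
                            (ℕₚ.m≤n+o⇒m∸n≤o #V (#components S) (n≤cL+length (elements S)))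
    ; rk-monotone = λ S⊆T → ℕₚ.∸-monoʳ-≤ #V (cL-antitone (λ x → ∈-elements⁺ (S⊆T (∈-elements⁻ x))))
    ; submodular  = graphRk-submodular
    }

------------------------------------------------------------------------
-- Coupled multicommodity flows

record FiniteAbelianGroup (c ℓ : Level) : Set (lsuc (c ⊔ ℓ)) where
  field
    abelianGroup : AbelianGroup c ℓ
  open AbelianGroup abelianGroup public
    using (Carrier; _≈_; ∙-cong; rawMonoid; setoid) renaming (ε to 0#)
  field
    finite : Finite setoid

  order : ℕ
  order = card finite

  _≈?_ : ∀ x y → Dec (x ≈ y)
  _≈?_ = Finite⇒≈? finite

-- Groups and flows are numbered from 1, unlike the elements of Fin k.
index : ∀ {k} → Fin k → ℕ
index i = suc (toℕ i)

module _ {c ℓ : Level} {G : Graph} (G′ : Orientation G) where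
  open Graph G
  open Orientation G′

  module _ (A : FiniteAbelianGroup c ℓ) where
    open FiniteAbelianGroup A

    -- An arc (v , j) of E′ is the same thing as an edge with tail v, so
    -- the sum over all such j is taken over these edges.
    outflow inflow : (Fin #E → Carrier) → Fin #V → Carrier
    outflow f v = RawMonoidOps.sum rawMonoid λ e → if does (tail e ≟ v) then f e else 0#
    inflow  f v = RawMonoidOps.sum rawMonoid λ e → if does (head e ≟ v) then f e else 0#

    Kirchhoff : (Fin #E → Carrier) → Set ℓ
    Kirchhoff f = ∀ v → outflow f v ≈ inflow f v

  module _ {k : ℕ} (A : Fin k → FiniteAbelianGroup c ℓ) where
    open module A (i : Fin k) = FiniteAbelianGroup (A i) using (Carrier; _≈_; 0#; _≈?_)

    tupleSetoid : Setoid c ℓ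
    tupleSetoid = Π-setoid λ i → Π-setoid λ (_ : Fin #E) → A.setoid i

    Tuple : Set c
    Tuple = Setoid.Carrier tupleSetoid

    Vanishes : Tuple → Fin #E → Fin k → Set ℓ
    Vanishes f e i = _≈_ i (f i e) (0# i)

    -- With 2m = index j, the bound i ≤ 2m - 1 reads index i < index j.
    EvenCondition : Tuple → Fin #E → Set ℓ
    EvenCondition f e = ∀ j → 2 ∣ index j →
      (∀ i → 2 ∤ index i → index i < index j → Vanishes f e i) → Vanishes f e j

    -- The bound i ≤ k - 2 is stated without subtraction, to cover k = 1.
    OddCondition : Tuple → Fin #E → Set ℓ
    OddCondition f e = 2 ∤ k → ∀ j → index j ≡ k →
      (∀ i → 2 ∤ index i → index i + 2 ≤ k → Vanishes f e i) → ¬ Vanishes f e j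

    IsCoupledFlow : Tuple → Set ℓ
    IsCoupledFlow f = (∀ i → Kirchhoff (A i) (f i)) × (∀ e → EvenCondition f e × OddCondition f e)

    coupledFlows : Setoid (c ⊔ ℓ) ℓ
    coupledFlows = subsetoid tupleSetoid IsCoupledFlow

    IsCoupledFlow? : ∀ f → Dec (IsCoupledFlow f)
    IsCoupledFlow? f =
      (all? λ i → all? λ v → _≈?_ i (outflow (A i) (f i) v) (inflow (A i) (f i) v))
      ×-dec (all? λ e →
        (all? λ j → (2 ∣? index j) →-dec
          ((all? λ i → ¬? (2 ∣? index i) →-dec ((index i <? index j) →-dec vanishes? e i)) →-dec vanishes? e j))
        ×-dec
        (¬? (2 ∣? k) →-dec (all? λ j → (index j ℕ.≟ k) →-dec
          ((all? λ i → ¬? (2 ∣? index i) →-dec ((index i + 2 ≤? k) →-dec vanishes? e i)) →-dec ¬? (vanishes? e j)))))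
      where
      vanishes? : ∀ e i → Dec (Vanishes f e i)
      vanishes? e i = _≈?_ i (f i e) (0# i)

    IsCoupledFlow-resp : ∀ {f g} → Setoid._≈_ tupleSetoid f g → IsCoupledFlow f → IsCoupledFlow g
    IsCoupledFlow-resp {f} {g} f≈g (kirchhoff , coupled) =
      (λ i v → let module S = Setoid (A.setoid i) in
         S.trans (S.sym (sum-resp i (λ e → tail e ≟ v))) (S.trans (kirchhoff i v) (sum-resp i (λ e → head e ≟ v))))
      , λ e →
        (λ j 2∣j h → f⇒g e j (proj₁ (coupled e) j 2∣j (λ i p q → g⇒f e i (h i p q))))
        , (λ 2∤k j eq h → proj₂ (coupled e) 2∤k j eq (λ i p q → g⇒f e i (h i p q)) ∘ g⇒f e j)
      where
      f⇒g : ∀ e i → Vanishes f e i → Vanishes g e i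
      f⇒g e i = Setoid.trans (A.setoid i) (Setoid.sym (A.setoid i) (f≈g i e))
      g⇒f : ∀ e i → Vanishes g e i → Vanishes f e i
      g⇒f e i = Setoid.trans (A.setoid i) (f≈g i e)
      sum-cong : ∀ i {n} {x y : Fin n → Carrier i} → (∀ e → _≈_ i (x e) (y e)) →
                 _≈_ i (RawMonoidOps.sum (A.rawMonoid i) x) (RawMonoidOps.sum (A.rawMonoid i) y)
      sum-cong i {zero}  p = Setoid.refl (A.setoid i)
      sum-cong i {suc n} p = A.∙-cong i (p zero) (sum-cong i (p ∘ suc))
      sum-resp : ∀ i {P : Fin #E → Set} (P? : ∀ e → Dec (P e)) →
                 _≈_ i (RawMonoidOps.sum (A.rawMonoid i) λ e → if does (P? e) then f i e else 0# i)
                       (RawMonoidOps.sum (A.rawMonoid i) λ e → if does (P? e) then g i e else 0# i)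
      sum-resp i P? = sum-cong i λ e → if-cong e
        where
        if-cong : ∀ e → _≈_ i (if does (P? e) then f i e else 0# i) (if does (P? e) then g i e else 0# i)
        if-cong e with P? e
        ... | yes _ = f≈g i e
        ... | no  _ = Setoid.refl (A.setoid i)

    coupledFlows-finite : Finite coupledFlows
    coupledFlows-finite = subsetoid-finite IsCoupledFlow IsCoupledFlow? IsCoupledFlow-resp
      (Π-finite _ λ i → Π-finite _ λ _ → A.finite i)

    Flow : ℕ
    Flow = card coupledFlows-finite

{-# OPTIONS --safe #-}

-- Write a flow tuple edge by edge: the two conditions on e say that the first
-- index i with f_i(e) ≠ 0 is odd, where k + 1 counts as that index if there is
-- none.  The indicator of this is the alternating sum ∑ (-1)^#{i | b_i = 0}
-- over the monotone bit vectors b with b_i = 1 whenever f_i(e) ≠ 0.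
-- Multiplying over the edges turns the bit vectors into chains of subsets
-- B_1 ⊆ ⋯ ⊆ B_k with supp f_i ⊆ B_i, and for a fixed chain the sum over tuples
-- factors into the numbers of A_i-flows supported on B_i.  Such a number is
-- t_i^(|B_i| - rk B_i): adding an edge to B_i multiplies it by t_i if the edge
-- closes a cycle, and leaves it unchanged if the edge is a bridge.

module Submission where

open import Defs
open import Level using (Level; _⊔_)
open import Algebra.Bundles using (AbelianGroup)
import Algebra.Properties.AbelianGroup as AbelianGroupProperties
import Algebra.Properties.CommutativeMonoid.Sum as CommutativeMonoidSum
import Algebra.Properties.CommutativeSemigroup as CommutativeSemigroupProperties
import Algebra.Properties.Semiring.Sum as SemiringSum
open import Data.Bool using (Bool; true; false; if_then_else_; not; _∨_; T; T?; b≤b)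
  renaming (_≤_ to _≤ᵇ_; _≤?_ to _≤ᵇ?_)
open import Data.Bool.Properties using (≤-minimum)
open import Data.Fin using (Fin; zero; suc; _↑ˡ_; _↑ʳ_; combine; remQuot; punchIn)
open import Data.Fin.Permutation using (↔⇒≡)
open import Data.Fin.Properties
  using (_≟_; all?; suc-injective; punchInᵢ≢i; remQuot-combine; combine-remQuot)
open import Data.Fin.Subset using (Subset; inside; outside; _⊆_; ∣_∣)
open import Data.Fin.Subset.Properties using (_⊆?_; ⊆⊤)
open import Data.Integer using (ℤ; +_; 0ℤ; 1ℤ; -1ℤ; _*_; _-_; _^_) renaming (_+_ to _+ℤ_)
import Data.Integer.Properties as ℤₚ
open import Data.Integer.Tactic.RingSolver using (solve-∀)
open import Data.List using (List; []; _∷_; _++_; map; filter; length; cartesianProductWith)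
open import Data.List.Membership.DecPropositional using (_∈?_)
open import Data.List.Membership.Propositional using (_∈_; _∉_)
open import Data.List.Membership.Propositional.Properties using (∈-map⁻)
import Data.List.Relation.Unary.All as All
open import Data.List.Relation.Unary.AllPairs using ([]; _∷_)
open import Data.List.Relation.Unary.Any using (here; there)
open import Data.List.Relation.Unary.Unique.Propositional using (Unique)
import Data.List.Relation.Unary.Unique.Propositional.Properties as Unique
open import Data.Nat using (ℕ; zero; suc; _+_; _∸_; _≤_; _<_; s≤s; z≤n)
  renaming (_*_ to _*ℕ_; _^_ to _^ℕ_)
open import Data.Nat.Divisibility using (_∣_; _∤_; ∣m+n∣m⇒∣n; ∣m∣n⇒∣m+n; ∣-refl; ∣1⇒≡1)
import Data.Nat.Properties as ℕₚ
open import Data.Product using (∃; _×_; _,_; proj₁; proj₂)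
open import Data.Sum using (inj₁; inj₂)
open import Data.Unit using (tt)
open import Data.Vec using (Vec; []; _∷_; lookup; zipWith) renaming (map to mapᵛ)
open import Data.Vec.Properties using (lookup⇒[]=; []=⇒lookup; lookup-map)
open import Data.Vec.Relation.Unary.Linked as Linked using (Linked; []; [-]; _∷_; linked?)
open import Function using (_∘_)
open import Function.Bundles using (Inverse; mk⇔)
import Function.Construct.Composition as Composition
import Function.Construct.Symmetry as Symmetry
open import Relation.Binary using (Setoid)
import Relation.Binary.Construct.Closure.Equivalence as Eq
open import Relation.Binary.Construct.Closure.Equivalence using (EqClosure)
open import Relation.Binary.Construct.Closure.ReflexiveTransitive using (ε; _◅_; _◅◅_)
open import Relation.Binary.Construct.Closure.Symmetric using (fwd; bwd)
open import Relation.Binary.PropositionalEquality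
  using (_≡_; _≢_; refl; sym; trans; cong; cong₂; subst; subst₂; module ≡-Reasoning)
import Relation.Binary.Reasoning.Setoid as SetoidReasoning
open import Relation.Nullary using (¬_; Dec; yes; no; contradiction; does; ¬?)
open import Relation.Nullary.Decidable using (_×-dec_; _→-dec_; does-⇔; dec-true; dec-false)

-- The obstacle is that the conditions on an edge tie the groups together, so the sum over tuples
-- does not factor as it stands. Expanding each edge indicator over bit vectors removes the tie:
-- monotonicity involves no flow value, and the remaining weight is a product over pairs of an edge
-- and an index. Once the two products are exchanged, a fixed chain leaves factors that each see a
-- single `f i`. Supports contained in `B_i`, and not equal to it, are the right notion because the
-- flows vanishing off `B_i` form a group whose order is a power of `t_i`. The prefactor comes from
-- counting zero bits: index `i` has `|E| - |B_i|` of them, hence contributes `(-1)^|E| (-1)^|B_i|`.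
-- The second equation holds already factor by factor: the bases become `-1` and `-t_i`, and their
-- exponents add up to `rk(G) + |B_i| - 2 rk(B_i)`, which leaves only the sign `(-1)^rk(G)` at each
-- index.

module ℤΣ = SemiringSum ℤₚ.+-*-semiring
module ℤ∏ = CommutativeMonoidSum ℤₚ.*-1-commutativeMonoid

-- Sums over lists

module _ {a} {X : Set a} where

  ∑-cong : ∀ (xs : List X) {φ ψ : X → ℤ} → (∀ x → φ x ≡ ψ x) → ∑ xs φ ≡ ∑ xs ψ
  ∑-cong []       φ≗ψ = refl
  ∑-cong (x ∷ xs) φ≗ψ = cong₂ _+ℤ_ (φ≗ψ x) (∑-cong xs φ≗ψ)

  ∑-++ : ∀ (xs ys : List X) φ → ∑ (xs ++ ys) φ ≡ ∑ xs φ +ℤ ∑ ys φ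
  ∑-++ []       ys φ = sym (ℤₚ.+-identityˡ _)
  ∑-++ (x ∷ xs) ys φ = trans (cong (φ x +ℤ_) (∑-++ xs ys φ)) (sym (ℤₚ.+-assoc (φ x) _ _))

  *-distribˡ-∑ : ∀ z (xs : List X) φ → z * ∑ xs φ ≡ ∑ xs λ x → z * φ x
  *-distribˡ-∑ z []       φ = ℤₚ.*-zeroʳ z
  *-distribˡ-∑ z (x ∷ xs) φ = trans (ℤₚ.*-distribˡ-+ z (φ x) _) (cong (z * φ x +ℤ_) (*-distribˡ-∑ z xs φ))

  *-distribʳ-∑ : ∀ z (xs : List X) φ → ∑ xs φ * z ≡ ∑ xs λ x → φ x * z
  *-distribʳ-∑ z []       φ = ℤₚ.*-zeroˡ z
  *-distribʳ-∑ z (x ∷ xs) φ = trans (ℤₚ.*-distribʳ-+ z (φ x) _) (cong (φ x * z +ℤ_) (*-distribʳ-∑ z xs φ))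

  ∑-zero : ∀ (xs : List X) → (∑ xs λ _ → 0ℤ) ≡ 0ℤ
  ∑-zero []       = refl
  ∑-zero (x ∷ xs) = trans (ℤₚ.+-identityˡ _) (∑-zero xs)

  ∑-distrib-+ : ∀ (xs : List X) φ ψ → (∑ xs λ x → φ x +ℤ ψ x) ≡ ∑ xs φ +ℤ ∑ xs ψ
  ∑-distrib-+ []       φ ψ = refl
  ∑-distrib-+ (x ∷ xs) φ ψ = trans (cong ((φ x +ℤ ψ x) +ℤ_) (∑-distrib-+ xs φ ψ)) (interchange (φ x) (ψ x) _ _)
    where open CommutativeSemigroupProperties ℤₚ.+-commutativeSemigroup using (interchange)

  sum-∑-swap : ∀ {n} (xs : List X) (φ : Fin n → X → ℤ) →
               (ℤΣ.sum λ j → ∑ xs (φ j)) ≡ ∑ xs λ x → ℤΣ.sum λ j → φ j x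
  sum-∑-swap {zero}  xs φ = sym (∑-zero xs)
  sum-∑-swap {suc n} xs φ = trans (cong (∑ xs (φ zero) +ℤ_) (sum-∑-swap xs (φ ∘ suc)))
                                  (sym (∑-distrib-+ xs (φ zero) _))

  ∑-map : ∀ {b} {Y : Set b} (g : Y → X) ys φ → ∑ (map g ys) φ ≡ ∑ ys (φ ∘ g)
  ∑-map g []       φ = refl
  ∑-map g (y ∷ ys) φ = cong (φ (g y) +ℤ_) (∑-map g ys φ)

module _ {a b} {X : Set a} {Y : Set b} where

  ∑-swap : ∀ (xs : List X) (ys : List Y) (φ : X → Y → ℤ) →
           (∑ xs λ x → ∑ ys λ y → φ x y) ≡ ∑ ys λ y → ∑ xs λ x → φ x y
  ∑-swap []       ys φ = sym (∑-zero ys)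
  ∑-swap (x ∷ xs) ys φ = trans (cong (∑ ys (φ x) +ℤ_) (∑-swap xs ys φ)) (sym (∑-distrib-+ ys (φ x) _))

  ∑-cartesianProductWith : ∀ {c} {Z : Set c} (g : X → Y → Z) xs ys φ →
    ∑ (cartesianProductWith g xs ys) φ ≡ ∑ xs λ x → ∑ ys λ y → φ (g x y)
  ∑-cartesianProductWith g []       ys φ = refl
  ∑-cartesianProductWith g (x ∷ xs) ys φ = trans (∑-++ (map (g x) ys) _ φ)
    (cong₂ _+ℤ_ (∑-map (g x) ys φ) (∑-cartesianProductWith g xs ys φ))

module _ {a b c} {X : Set a} {Y : Set b} {Z : Set c} where

  -- Serves the induction on the number of edges: `subsets (suc m)` is by definition such a product
  -- of `bits` and `subsets m`, so a family of subsets splits into the bits at edge `zero` and a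
  -- family on the other edges.
  ∑-vectors-cartesianProductWith : ∀ (g : X → Y → Z) xs ys n φ →
    ∑ (vectors (cartesianProductWith g xs ys) n) φ ≡
    ∑ (vectors xs n) λ u → ∑ (vectors ys n) λ v → φ (zipWith g u v)
  ∑-vectors-cartesianProductWith g xs ys zero    φ = sym (ℤₚ.+-identityʳ _)
  ∑-vectors-cartesianProductWith g xs ys (suc n) φ = begin
    ∑ (vectors (cartesianProductWith g xs ys) (suc n)) φ
      ≡⟨ ∑-cartesianProductWith _∷_ (cartesianProductWith g xs ys) zs φ ⟩
    (∑ (cartesianProductWith g xs ys) λ z → ∑ zs λ w → φ (z ∷ w))
      ≡⟨ ∑-cartesianProductWith g xs ys (λ z → ∑ zs λ w → φ (z ∷ w)) ⟩
    (∑ xs λ x → ∑ ys λ y → ∑ zs λ w → φ (g x y ∷ w))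
      ≡⟨ (∑-cong xs λ x → ∑-cong ys λ y → ∑-vectors-cartesianProductWith g xs ys n (φ ∘ (g x y ∷_))) ⟩
    (∑ xs λ x → ∑ ys λ y → ∑ us λ u → ∑ vs λ v → φ (g x y ∷ zipWith g u v))
      ≡⟨ (∑-cong xs λ x → ∑-swap ys us λ y u → ∑ vs λ v → φ (g x y ∷ zipWith g u v)) ⟩
    (∑ xs λ x → ∑ us λ u → ∑ ys λ y → ∑ vs λ v → φ (g x y ∷ zipWith g u v))
      ≡⟨ (∑-cong xs λ x → ∑-cong us λ u → ∑-cartesianProductWith _∷_ ys vs (λ v → φ (zipWith g (x ∷ u) v))) ⟨
    (∑ xs λ x → ∑ us λ u → ∑ (vectors ys (suc n)) λ v → φ (zipWith g (x ∷ u) v))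
      ≡⟨ ∑-cartesianProductWith _∷_ xs us (λ u → ∑ (vectors ys (suc n)) λ v → φ (zipWith g u v)) ⟨
    (∑ (vectors xs (suc n)) λ u → ∑ (vectors ys (suc n)) λ v → φ (zipWith g u v)) ∎
    where
    open ≡-Reasoning
    us = vectors xs n
    vs = vectors ys n
    zs = vectors (cartesianProductWith g xs ys) n

-- A family of subsets is a family of bit vectors, one for each element.

bits : List Bool
bits = outside ∷ inside ∷ []

column : ∀ {k m} → Fin m → Vec (Subset m) k → Vec Bool k
column e = mapᵛ λ S → lookup S e

column-zero : ∀ {k m} (b : Vec Bool k) (B : Vec (Subset m) k) → column zero (zipWith _∷_ b B) ≡ b
column-zero []      []      = refl
column-zero (x ∷ b) (_ ∷ B) = cong (x ∷_) (column-zero b B)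

column-suc : ∀ {k m} (e : Fin m) b (B : Vec (Subset m) k) → column (suc e) (zipWith _∷_ b B) ≡ column e B
column-suc e []      []      = refl
column-suc e (_ ∷ b) (S ∷ B) = cong (lookup S e ∷_) (column-suc e b B)

∑-vectors-[] : ∀ k → (∑ (vectors (subsets 0) k) λ _ → 1ℤ) ≡ 1ℤ
∑-vectors-[] zero    = refl
∑-vectors-[] (suc k) = trans (∑-cartesianProductWith _∷_ (subsets 0) (vectors (subsets 0) k) λ _ → 1ℤ)
                             (trans (ℤₚ.+-identityʳ _) (∑-vectors-[] k))

-- Distributivity: expanding the product picks one bit vector per edge, and these picks are the
-- columns of a family of `k` subsets. All families occur; restricting to chains is left to `ψ`.
∏-∑ : ∀ {m} k (ψ : Fin m → Vec Bool k → ℤ) →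
      (∏ λ e → ∑ (vectors bits k) (ψ e)) ≡ ∑ (vectors (subsets m) k) λ B → ∏ λ e → ψ e (column e B)
∏-∑ {zero}  k ψ = sym (∑-vectors-[] k)
∏-∑ {suc m} k ψ = begin
  ∑ bs (ψ zero) * (∏ λ e → ∑ bs (ψ (suc e)))
    ≡⟨ cong (∑ bs (ψ zero) *_) (∏-∑ k (ψ ∘ suc)) ⟩
  ∑ bs (ψ zero) * (∑ Bs λ B → ∏ λ e → ψ (suc e) (column e B))
    ≡⟨ *-distribʳ-∑ _ bs (ψ zero) ⟩
  (∑ bs λ b → ψ zero b * (∑ Bs λ B → ∏ λ e → ψ (suc e) (column e B)))
    ≡⟨ (∑-cong bs λ b → *-distribˡ-∑ (ψ zero b) Bs _) ⟩
  (∑ bs λ b → ∑ Bs λ B → ψ zero b * (∏ λ e → ψ (suc e) (column e B)))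
    ≡⟨ (∑-cong bs λ b → ∑-cong Bs λ B → cong₂ _*_ (cong (ψ zero) (column-zero b B))
         (ℤ∏.sum-cong-≗ λ e → cong (ψ (suc e)) (column-suc e b B))) ⟨
  (∑ bs λ b → ∑ Bs λ B → ∏ λ e → ψ e (column e (zipWith _∷_ b B)))
    ≡⟨ ∑-vectors-cartesianProductWith _∷_ bits (subsets m) k (λ B → ∏ λ e → ψ e (column e B)) ⟨
  (∑ (vectors (subsets (suc m)) k) λ B → ∏ λ e → ψ e (column e B)) ∎
  where
  open ≡-Reasoning
  bs = vectors bits k
  Bs = vectors (subsets m) k

⊆⇒lookup-≤ : ∀ {m} {S U : Subset m} → S ⊆ U → ∀ e → lookup S e ≤ᵇ lookup U e
⊆⇒lookup-≤ {S = S} S⊆U e with lookup S e in e∈S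
... | false = ≤-minimum _
... | true  rewrite []=⇒lookup (S⊆U (lookup⇒[]= e S e∈S)) = b≤b

lookup-≤⇒⊆ : ∀ {m} {S U : Subset m} → (∀ e → lookup S e ≤ᵇ lookup U e) → S ⊆ U
lookup-≤⇒⊆ {S = S} {U} S≤U {e} e∈S = lookup⇒[]= e U (inside≤ (subst (_≤ᵇ lookup U e) ([]=⇒lookup e∈S) (S≤U e)))
  where
  inside≤ : ∀ {b} → inside ≤ᵇ b → b ≡ inside
  inside≤ b≤b = refl

-- Inclusion is the pointwise order of bits. Being a chain is therefore a condition on each edge
-- separately, which is what a product over edges can express.
chain⇒columns : ∀ {k m} {B : Vec (Subset m) k} → Linked _⊆_ B → ∀ e → Linked _≤ᵇ_ (column e B)
chain⇒columns {B = []}        []      e = []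
chain⇒columns {B = S ∷ []}    [-]     e = [-]
chain⇒columns {B = S ∷ U ∷ B} (p ∷ q) e = ⊆⇒lookup-≤ p e ∷ chain⇒columns q e

columns⇒chain : ∀ {k m} {B : Vec (Subset m) k} → (∀ e → Linked _≤ᵇ_ (column e B)) → Linked _⊆_ B
columns⇒chain {B = []}        h = []
columns⇒chain {B = S ∷ []}    h = [-]
columns⇒chain {B = S ∷ U ∷ B} h = lookup-≤⇒⊆ (Linked.head ∘ h) ∷ columns⇒chain (Linked.tail ∘ h)

-- Indicators

ind : ∀ {p} {P : Set p} → Dec P → ℤ
ind P? = if does P? then 1ℤ else 0ℤ

ind-⇔ : ∀ {p q} {P : Set p} {Q : Set q} → (P → Q) → (Q → P) → (P? : Dec P) (Q? : Dec Q) → ind P? ≡ ind Q?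
ind-⇔ P⇒Q Q⇒P P? Q? = cong (if_then 1ℤ else 0ℤ) (does-⇔ (mk⇔ P⇒Q Q⇒P) P? Q?)

ind-yes : ∀ {p} {P : Set p} (P? : Dec P) → P → ind P? ≡ 1ℤ
ind-yes P? p = ind-⇔ (λ _ → tt) (λ _ → p) P? (yes tt)

ind-no : ∀ {p} {P : Set p} (P? : Dec P) → ¬ P → ind P? ≡ 0ℤ
ind-no (yes p) ¬p = contradiction p ¬p
ind-no (no _)  _  = refl

ind-× : ∀ {p q} {P : Set p} {Q : Set q} (P? : Dec P) (Q? : Dec Q) → ind (P? ×-dec Q?) ≡ ind P? * ind Q?
ind-× (yes _) Q? = sym (ℤₚ.*-identityˡ _)
ind-× (no _)  Q? = refl

ind-∀ : ∀ {n p} {P : Fin n → Set p} (P? : ∀ i → Dec (P i)) (∀P? : Dec (∀ i → P i)) → ind ∀P? ≡ ∏ λ i → ind (P? i)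
ind-∀ {zero}  P? ∀P? = ind-yes ∀P? λ ()
ind-∀ {suc n} P? ∀P? = trans
  (ind-⇔ (λ h → h zero , h ∘ suc) (λ { (h₀ , h) zero → h₀ ; (h₀ , h) (suc i) → h i })
         ∀P? (P? zero ×-dec all? (P? ∘ suc)))
  (trans (ind-× (P? zero) (all? (P? ∘ suc))) (cong (ind (P? zero) *_) (ind-∀ (P? ∘ suc) (all? (P? ∘ suc)))))

∑-filter : ∀ {a p} {X : Set a} {P : X → Set p} (P? : ∀ x → Dec (P x)) xs φ →
           ∑ (filter P? xs) φ ≡ ∑ xs λ x → ind (P? x) * φ x
∑-filter P? []       φ = refl
∑-filter P? (x ∷ xs) φ with P? x
... | yes _ = cong₂ _+ℤ_ (sym (ℤₚ.*-identityˡ (φ x))) (∑-filter P? xs φ)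
... | no  _ = trans (∑-filter P? xs φ) (sym (ℤₚ.+-identityˡ _))

-- Sums over finite setoids

sum-combine : ∀ p q (φ : Fin (p *ℕ q) → ℤ) → ℤΣ.sum φ ≡ ℤΣ.sum λ (i : Fin p) → ℤΣ.sum λ (j : Fin q) → φ (combine i j)
sum-combine zero    q φ = refl
sum-combine (suc p) q φ = trans (sum-+ q φ) (cong (ℤΣ.sum (λ j → φ (j ↑ˡ (p *ℕ q))) +ℤ_) (sum-combine p q (φ ∘ (q ↑ʳ_))))
  where
  sum-+ : ∀ m {n} (φ : Fin (m + n) → ℤ) → ℤΣ.sum φ ≡ ℤΣ.sum (λ i → φ (i ↑ˡ n)) +ℤ ℤΣ.sum (λ j → φ (m ↑ʳ j))
  sum-+ zero    φ = sym (ℤₚ.+-identityˡ _)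
  sum-+ (suc m) φ = trans (cong (φ zero +ℤ_) (sum-+ m (φ ∘ suc))) (sym (ℤₚ.+-assoc (φ zero) _ _))

sumOver : ∀ {a ℓ} {S : Setoid a ℓ} → Finite S → (Setoid.Carrier S → ℤ) → ℤ
sumOver F φ = ℤΣ.sum (φ ∘ Inverse.from (proj₂ F))

-- `Π-finite` numbers tuples by `combine`, so the sum is an iterated one and distributivity applies.
-- Both sides evaluate `φ` at the same representatives, so `φ` may distinguish equal elements of the
-- setoids.
sumOver-Π : ∀ {n a ℓ} (S : Fin n → Setoid a ℓ) (fin : ∀ i → Finite (S i)) (φ : ∀ i → Setoid.Carrier (S i) → ℤ) →
            sumOver (Π-finite S fin) (λ f → ∏ λ i → φ i (f i)) ≡ ∏ λ i → sumOver (fin i) (φ i)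
sumOver-Π {zero}  S fin φ = refl
sumOver-Π {suc n} S fin φ = begin
  sumOver (Π-finite S fin) (λ f → ∏ λ i → φ i (f i))
    ≡⟨ sum-combine p q _ ⟩
  (ℤΣ.sum {p} λ x → ℤΣ.sum {q} λ y → ∏ λ i → φ i (F.from (combine x y) i))
    ≡⟨ (ℤΣ.sum-cong-≗ {p} λ x → ℤΣ.sum-cong-≗ {q} λ y → cong₂ _*_
         (cong (φ zero ∘ I.from ∘ proj₁) (remQuot-combine {p} {q} x y))
         (ℤ∏.sum-cong-≗ λ i → cong (λ z → φ (suc i) (J.from (proj₂ z) i)) (remQuot-combine {p} {q} x y))) ⟩
  (ℤΣ.sum {p} λ x → ℤΣ.sum {q} λ y → φ zero (I.from x) * ∏ λ i → φ (suc i) (J.from y i))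
    ≡⟨ (ℤΣ.sum-cong-≗ {p} λ x → ℤΣ.*-distribˡ-sum {n = q} (φ zero (I.from x)) _) ⟨
  (ℤΣ.sum {p} λ x → φ zero (I.from x) * sumOver rest (λ f → ∏ λ i → φ (suc i) (f i)))
    ≡⟨ ℤΣ.*-distribʳ-sum {n = p} _ (φ zero ∘ I.from) ⟨
  sumOver (fin zero) (φ zero) * sumOver rest (λ f → ∏ λ i → φ (suc i) (f i))
    ≡⟨ cong (sumOver (fin zero) (φ zero) *_) (sumOver-Π (S ∘ suc) (fin ∘ suc) (φ ∘ suc)) ⟩
  (∏ λ i → sumOver (fin i) (φ i)) ∎
  where
  open ≡-Reasoning
  rest = Π-finite (S ∘ suc) (fin ∘ suc)
  p = card (fin zero)
  q = card rest
  module F = Inverse (proj₂ (Π-finite S fin))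
  module I = Inverse (proj₂ (fin zero))
  module J = Inverse (proj₂ rest)

card-Fin-sub-finite : ∀ {n p} (Q : Fin n → Set p) (Q? : ∀ i → Dec (Q i)) →
                      + card (Fin-sub-finite Q Q?) ≡ ℤΣ.sum (ind ∘ Q?)
card-Fin-sub-finite {zero}  Q Q? = refl
card-Fin-sub-finite {suc n} Q Q?
  with Fin-sub-finite (Q ∘ suc) (Q? ∘ suc) | card-Fin-sub-finite (Q ∘ suc) (Q? ∘ suc) | Q? zero
... | _ , _ | ih | yes _ = cong (1ℤ +ℤ_) ih
... | _ , _ | ih | no  _ = trans ih (sym (ℤₚ.+-identityˡ _))

card-subsetoid-finite : ∀ {a ℓ p} {S : Setoid a ℓ} (P : Setoid.Carrier S → Set p) P?
  (resp : ∀ {x y} → Setoid._≈_ S x y → P x → P y) (F : Finite S) →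
  + card (subsetoid-finite P P? resp F) ≡ sumOver F (ind ∘ P?)
card-subsetoid-finite P P? resp F = card-Fin-sub-finite (P ∘ from) (P? ∘ from)
  where open Inverse (proj₂ F)

-- Signs of monotone bit vectors

sign : Bool → ℤ
sign b = if b then -1ℤ else 1ℤ

-- The factor `-1ℤ * sign b` is `-1` for a zero bit and `1` for a one bit. The constant `-1ℤ` is
-- kept apart because its product over the edges becomes the prefactor.
weight : Bool → Bool → ℤ
weight z b = ind (z ≤ᵇ? b) * (-1ℤ * sign b)

weight-true : ∀ z → weight z true ≡ 1ℤ
weight-true true  = refl
weight-true false = refl

-- Positions count from 1; without a true entry, k + 1 counts as the first.
firstOdd : ∀ {k} → (Fin k → Bool) → Bool
firstOdd {zero}  z = true
firstOdd {suc k} z = z zero ∨ not (firstOdd (z ∘ suc))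

monotone : ∀ {k} (b : Vec Bool k) → Dec (Linked _≤ᵇ_ b)
monotone = linked? _≤ᵇ?_

∑-vectors-bits : ∀ k (φ : Vec Bool (suc k) → ℤ) →
  ∑ (vectors bits (suc k)) φ ≡ ∑ (vectors bits k) (φ ∘ (false ∷_)) +ℤ ∑ (vectors bits k) (φ ∘ (true ∷_))
∑-vectors-bits k φ = trans (∑-cartesianProductWith _∷_ bits (vectors bits k) φ)
  (cong (∑ (vectors bits k) (φ ∘ (false ∷_)) +ℤ_) (ℤₚ.+-identityʳ _))

-- After a leading `true` only the all-true vector is monotone. It dominates every `z`, and all its
-- weights are 1.
∑-monotone-true : ∀ {k} (z : Fin k → Bool) →
  (∑ (vectors bits k) λ b → ind (monotone (true ∷ b)) * ∏ λ i → weight (z i) (lookup b i)) ≡ 1ℤ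
∑-monotone-true {zero}  z = refl
∑-monotone-true {suc k} z = begin
  ∑ (vectors bits (suc k)) φ                                            ≡⟨ ∑-vectors-bits k φ ⟩
  ∑ (vectors bits k) (φ ∘ (false ∷_)) +ℤ ∑ (vectors bits k) (φ ∘ (true ∷_)) ≡⟨ cong₂ _+ℤ_ falses trues ⟩
  1ℤ                                                                    ∎
  where
  open ≡-Reasoning
  φ : Vec Bool (suc k) → ℤ
  φ b = ind (monotone (true ∷ b)) * ∏ λ i → weight (z i) (lookup b i)
  falses : ∑ (vectors bits k) (φ ∘ (false ∷_)) ≡ 0ℤ
  falses = trans (∑-cong (vectors bits k) λ b →
    cong (_* (∏ λ i → weight (z i) (lookup (false ∷ b) i))) (ind-no (monotone (true ∷ false ∷ b)) λ { (() ∷ _) })) (∑-zero (vectors bits k))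
  trues : ∑ (vectors bits k) (φ ∘ (true ∷_)) ≡ 1ℤ
  trues = trans (∑-cong (vectors bits k) λ b → cong₂ _*_
    (ind-⇔ Linked.tail (b≤b ∷_) (monotone (true ∷ true ∷ b)) (monotone (true ∷ b)))
    (trans (cong (_* (∏ λ i → weight (z (suc i)) (lookup b i))) (weight-true (z zero))) (ℤₚ.*-identityˡ _)))
    (∑-monotone-true (z ∘ suc))

-- The vectors b ≥ z that are monotone are 0ˢ1ᵏ⁻ˢ with s at most the position
-- of the first 1 in z (or k), so the sum is 1 - 1 + 1 - ⋯.
∑-monotone : ∀ {k} (z : Fin k → Bool) →
  (∑ (vectors bits k) λ b → ind (monotone b) * ∏ λ i → weight (z i) (lookup b i)) ≡ ind (T? (firstOdd z))
∑-monotone {zero}  z = refl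
∑-monotone {suc k} z = begin
  ∑ (vectors bits (suc k)) φ                                            ≡⟨ ∑-vectors-bits k φ ⟩
  ∑ (vectors bits k) (φ ∘ (false ∷_)) +ℤ ∑ (vectors bits k) (φ ∘ (true ∷_)) ≡⟨ cong₂ _+ℤ_ falses trues ⟩
  weight (z zero) false * ind (T? (firstOdd (z ∘ suc))) +ℤ 1ℤ           ≡⟨ parity (z zero) (firstOdd (z ∘ suc)) ⟩
  ind (T? (firstOdd z))                                                 ∎
  where
  open ≡-Reasoning
  open CommutativeSemigroupProperties ℤₚ.*-commutativeSemigroup using (x∙yz≈y∙xz)
  φ : Vec Bool (suc k) → ℤ
  φ b = ind (monotone b) * ∏ λ i → weight (z i) (lookup b i)
  rest : Vec Bool k → ℤ
  rest b = ∏ λ i → weight (z (suc i)) (lookup b i)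
  false-∷ : ∀ {n} {b : Vec Bool n} → Linked _≤ᵇ_ b → Linked _≤ᵇ_ (false ∷ b)
  false-∷ {b = []}    _ = [-]
  false-∷ {b = _ ∷ _} p = ≤-minimum _ ∷ p
  falses : ∑ (vectors bits k) (φ ∘ (false ∷_)) ≡ weight (z zero) false * ind (T? (firstOdd (z ∘ suc)))
  falses = begin
    ∑ (vectors bits k) (φ ∘ (false ∷_))
      ≡⟨ (∑-cong (vectors bits k) λ b → trans
           (cong (_* (weight (z zero) false * rest b)) (ind-⇔ Linked.tail false-∷ (monotone (false ∷ b)) (monotone b)))
           (x∙yz≈y∙xz (ind (monotone b)) (weight (z zero) false) (rest b))) ⟩
    (∑ (vectors bits k) λ b → weight (z zero) false * (ind (monotone b) * rest b))
      ≡⟨ *-distribˡ-∑ (weight (z zero) false) (vectors bits k) _ ⟨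
    weight (z zero) false * (∑ (vectors bits k) λ b → ind (monotone b) * rest b)
      ≡⟨ cong (weight (z zero) false *_) (∑-monotone (z ∘ suc)) ⟩
    weight (z zero) false * ind (T? (firstOdd (z ∘ suc))) ∎
  trues : ∑ (vectors bits k) (φ ∘ (true ∷_)) ≡ 1ℤ
  trues = trans (∑-cong (vectors bits k) λ b → cong (ind (monotone (true ∷ b)) *_)
      (trans (cong (_* rest b) (weight-true (z zero))) (ℤₚ.*-identityˡ _)))
    (∑-monotone-true (z ∘ suc))
  -- A one bit in `z` excludes `false`, leaving 1; a zero bit gives `false` the weight `-1`, leaving
  -- `1 - [y]`, the indicator of the negation.
  parity : ∀ x y → weight x false * ind (T? y) +ℤ 1ℤ ≡ ind (T? (x ∨ not y))
  parity true  true  = refl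
  parity true  false = refl
  parity false true  = refl
  parity false false = refl

-- The coupling conditions as parity of the first nonzero index

2∤1 : 2 ∤ 1
2∤1 2∣1 with () ← ∣1⇒≡1 2∣1

∣-2+⁺ : ∀ {n} → 2 ∣ n → 2 ∣ suc (suc n)
∣-2+⁺ = ∣m∣n⇒∣m+n ∣-refl

∣-2+⁻ : ∀ {n} → 2 ∣ suc (suc n) → 2 ∣ n
∣-2+⁻ 2∣n+2 = ∣m+n∣m⇒∣n 2∣n+2 ∣-refl

T-not-not⁻ : ∀ b → T (not (not b)) → T b
T-not-not⁻ true _ = tt

T-not-not⁺ : ∀ b → T b → T (not (not b))
T-not-not⁺ true _ = tt

module _ {ℓ : Level} where

  -- The conditions at one edge, with `Z i` standing for the vanishing of `f i` there. An arbitrary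
  -- family lets the induction discard leading indices.
  Even Odd : ∀ {k} → (Fin k → Set ℓ) → Set ℓ
  Even {k} Z = ∀ j → 2 ∣ index j → (∀ i → 2 ∤ index i → index i < index j → Z i) → Z j
  Odd  {k} Z = 2 ∤ k → ∀ j → index j ≡ k → (∀ i → 2 ∤ index i → index i + 2 ≤ k → Z i) → ¬ Z j

  nonzero : ∀ {k} {Z : Fin k → Set ℓ} → (∀ i → Dec (Z i)) → Fin k → Bool
  nonzero Z? = not ∘ does ∘ Z?

  -- Indices are consumed in pairs, since a shift by two preserves parity. For `k` at least 2, a
  -- nonzero value at index 1 falsifies the premises of both conditions; if the values at indices 1
  -- and 2 vanish, the conditions reduce to those of the remaining family.
  firstOdd⇒coupled : ∀ {k} {Z : Fin k → Set ℓ} (Z? : ∀ i → Dec (Z i)) →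
                     T (firstOdd (nonzero Z?)) → Even Z × Odd Z
  firstOdd⇒coupled {0} Z? t = (λ ()) , λ _ ()
  firstOdd⇒coupled {1} Z? t with Z? zero
  ... | no ¬z₀ = (λ { zero 2∣1 → contradiction 2∣1 2∤1 }) , λ { _ zero _ _ → ¬z₀ }
  firstOdd⇒coupled {suc (suc k)} {Z} Z? t with Z? zero | Z? (suc zero)
  ... | no ¬z₀ | _ = even , odd
    where
    even : Even Z
    even zero    2∣1 _ = contradiction 2∣1 2∤1
    even (suc j) _   h = contradiction (h zero 2∤1 (s≤s (s≤s z≤n))) ¬z₀
    -- Index 1 lies within the bound `k - 2` only from `k = 3` on; oddness rules out `k = 2`.
    3≤2+ : ∀ {n} → 2 ∤ 2 + n → 3 ≤ 2 + n
    3≤2+ {zero}  2∤2 = contradiction ∣-refl 2∤2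
    3≤2+ {suc n} _   = s≤s (s≤s (s≤s z≤n))
    odd : Odd Z
    odd 2∤k j _ h = contradiction (h zero 2∤1 (3≤2+ 2∤k)) ¬z₀
  -- If index 2 were the first nonzero one, `firstOdd` would be `false` and `t` would inhabit the
  -- empty type.
  ... | yes z₀ | yes z₁ = even , odd
    where
    ih = firstOdd⇒coupled (λ i → Z? (suc (suc i))) (T-not-not⁻ _ t)
    even : Even Z
    even zero          2∣1 _ = contradiction 2∣1 2∤1
    even (suc zero)    _   _ = z₁
    even (suc (suc j)) 2∣j h = proj₁ ih j (∣-2+⁻ 2∣j) λ i 2∤i i<j →
      h (suc (suc i)) (2∤i ∘ ∣-2+⁻) (s≤s (s≤s i<j))
    odd : Odd Z
    odd 2∤k zero          ()
    odd 2∤k (suc zero)    refl _ = contradiction ∣-refl 2∤k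
    odd 2∤k (suc (suc j)) j≡k h = proj₂ ih (2∤k ∘ ∣-2+⁺) j (ℕₚ.suc-injective (ℕₚ.suc-injective j≡k)) λ i 2∤i i≤k →
      h (suc (suc i)) (2∤i ∘ ∣-2+⁻) (s≤s (s≤s i≤k))

  coupled⇒firstOdd : ∀ {k} {Z : Fin k → Set ℓ} (Z? : ∀ i → Dec (Z i)) →
                     Even Z × Odd Z → T (firstOdd (nonzero Z?))
  coupled⇒firstOdd {0} Z? _ = tt
  coupled⇒firstOdd {1} Z? (_ , odd) with Z? zero
  ... | no _   = tt
  -- For `k = 1` no index satisfies the bound, so the premise is vacuous and `odd` forbids a zero.
  ... | yes z₀ = odd 2∤1 zero refl (λ { zero _ (s≤s ()) }) z₀
  coupled⇒firstOdd {suc (suc k)} {Z} Z? (even , odd) with Z? zero | Z? (suc zero)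
  ... | no _   | _      = tt
  ... | yes z₀ | no ¬z₁ = ¬z₁ (even (suc zero) ∣-refl λ where
    zero       _   _               → z₀
    (suc zero) 2∤2 _               → contradiction ∣-refl 2∤2
    (suc (suc i)) _ (s≤s (s≤s ())))
  ... | yes z₀ | yes z₁ = T-not-not⁺ _ (coupled⇒firstOdd (λ i → Z? (suc (suc i))) (even′ , odd′))
    where
    even′ : Even λ i → Z (suc (suc i))
    even′ j 2∣j h = even (suc (suc j)) (∣-2+⁺ 2∣j) λ where
      zero          _   _               → z₀
      (suc zero)    _   _               → z₁
      (suc (suc i)) 2∤i (s≤s (s≤s i<j)) → h i (2∤i ∘ ∣-2+⁺) i<j
    odd′ : Odd λ i → Z (suc (suc i))
    odd′ 2∤k j j≡k h = odd (2∤k ∘ ∣-2+⁻) (suc (suc j)) (cong (λ n → suc (suc n)) j≡k) λ where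
      zero          _   _               → z₀
      (suc zero)    _   _               → z₁
      (suc (suc i)) 2∤i (s≤s (s≤s i≤k)) → h i (2∤i ∘ ∣-2+⁺) i≤k

-- Flows supported on a set of edges

card-unique : ∀ {a ℓ} {S : Setoid a ℓ} {m n} → HasCardinality S m → HasCardinality S n → m ≡ n
card-unique I J = ↔⇒≡ (Composition.inverse (Symmetry.inverse I) J)

module Flux {c ℓ} (𝔸 : AbelianGroup c ℓ) where

  open AbelianGroup 𝔸 renaming (refl to ≈-refl; sym to ≈-sym; trans to ≈-trans; reflexive to ≈-reflexive; ε to 0#)
  open AbelianGroupProperties 𝔸
  open CommutativeSemigroupProperties commutativeSemigroup using (interchange)
  open CommutativeMonoidSum commutativeMonoid
    using (sum; sum-remove; sum-cong-≋; sum-replicate-zero; ∑-comm)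
    renaming (∑-distrib-+ to sum-distrib-∙)
  open SetoidReasoning setoid

  -- The balance at a vertex when two transports are concatenated: `m` is the contribution of the
  -- intermediate vertex, `u` and `v` those of the start and the end.
  ∙-cancel-middle : ∀ {o₁ o₂ i₁ i₂ u m v} → o₁ ∙ m ≈ i₁ ∙ u → o₂ ∙ v ≈ i₂ ∙ m → (o₁ ∙ o₂) ∙ v ≈ (i₁ ∙ i₂) ∙ u
  ∙-cancel-middle {o₁} {o₂} {i₁} {i₂} {u} {m} {v} p q = ∙-cancelʳ m _ _ (begin
    ((o₁ ∙ o₂) ∙ v) ∙ m ≈⟨ ∙-congʳ (assoc o₁ o₂ v) ⟩
    (o₁ ∙ (o₂ ∙ v)) ∙ m ≈⟨ assoc o₁ _ m ⟩
    o₁ ∙ ((o₂ ∙ v) ∙ m) ≈⟨ ∙-congˡ (comm _ m) ⟩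
    o₁ ∙ (m ∙ (o₂ ∙ v)) ≈⟨ assoc o₁ m _ ⟨
    (o₁ ∙ m) ∙ (o₂ ∙ v) ≈⟨ ∙-cong p q ⟩
    (i₁ ∙ u) ∙ (i₂ ∙ m) ≈⟨ interchange i₁ u i₂ m ⟩
    (i₁ ∙ i₂) ∙ (u ∙ m) ≈⟨ assoc _ u m ⟨
    ((i₁ ∙ i₂) ∙ u) ∙ m ∎)

  ∙-swap-inverses : ∀ {o i p q} → o ∙ p ⁻¹ ≈ i ∙ q ⁻¹ → o ∙ q ≈ i ∙ p
  ∙-swap-inverses {o} {i} {p} {q} eq = begin
    o ∙ q                 ≈⟨ ∙-congˡ (≈-trans (≈-sym (identityˡ q)) (∙-congʳ (≈-sym (inverseˡ p)))) ⟩
    o ∙ ((p ⁻¹ ∙ p) ∙ q)  ≈⟨ ∙-congˡ (assoc _ p q) ⟩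
    o ∙ (p ⁻¹ ∙ (p ∙ q))  ≈⟨ assoc o _ _ ⟨
    (o ∙ p ⁻¹) ∙ (p ∙ q)  ≈⟨ ∙-cong eq (comm p q) ⟩
    (i ∙ q ⁻¹) ∙ (q ∙ p)  ≈⟨ assoc i _ _ ⟩
    i ∙ (q ⁻¹ ∙ (q ∙ p))  ≈⟨ ∙-congˡ (assoc _ q p) ⟨
    i ∙ ((q ⁻¹ ∙ q) ∙ p)  ≈⟨ ∙-congˡ (≈-trans (∙-congʳ (inverseˡ q)) (identityˡ p)) ⟩
    i ∙ p                 ∎

  sum-≈0 : ∀ {n} {t : Fin n → Carrier} → (∀ i → t i ≈ 0#) → sum t ≈ 0#
  sum-≈0 {n} h = ≈-trans (sum-cong-≋ h) (sum-replicate-zero n)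

  sum-single : ∀ {n} (t : Fin n → Carrier) i → (∀ j → i ≢ j → t j ≈ 0#) → sum t ≈ t i
  sum-single {suc n} t i h = ≈-trans (sum-remove t)
    (≈-trans (∙-congˡ (sum-≈0 λ j → h (punchIn i j) (punchInᵢ≢i i j ∘ sym))) (identityʳ (t i)))

  sum-cancel : ∀ {n} (s t : Fin n → Carrier) i → (∀ j → i ≢ j → s j ≈ t j) → sum s ≈ sum t → s i ≈ t i
  sum-cancel {suc n} s t i h eq = ∙-cancelʳ (sum (t ∘ punchIn i)) _ _ (begin
    s i ∙ sum (t ∘ punchIn i) ≈⟨ ∙-congˡ (sum-cong-≋ λ j → h (punchIn i j) (punchInᵢ≢i i j ∘ sym)) ⟨
    s i ∙ sum (s ∘ punchIn i) ≈⟨ sum-remove s ⟨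
    sum s                     ≈⟨ eq ⟩
    sum t                     ≈⟨ sum-remove t ⟩
    t i ∙ sum (t ∘ punchIn i) ∎)

  if-cong : ∀ b {x y} → x ≈ y → (if b then x else 0#) ≈ (if b then y else 0#)
  if-cong true  x≈y = x≈y
  if-cong false x≈y = ≈-refl

  if-0 : ∀ b {x} → x ≈ 0# → (if b then x else 0#) ≈ 0#
  if-0 true  x≈0 = x≈0
  if-0 false _   = ≈-refl

  if-∙ : ∀ b x y → (if b then x ∙ y else 0#) ≈ (if b then x else 0#) ∙ (if b then y else 0#)
  if-∙ true  x y = ≈-refl
  if-∙ false x y = ≈-sym (identityˡ 0#)

  if-⁻¹ : ∀ b x → (if b then x ⁻¹ else 0#) ≈ (if b then x else 0#) ⁻¹
  if-⁻¹ true  x = ≈-refl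
  if-⁻¹ false x = ≈-sym ε⁻¹≈ε

  if-sum : ∀ b {n} (t : Fin n → Carrier) → (if b then sum t else 0#) ≈ sum λ i → if b then t i else 0#
  if-sum true  t = ≈-refl
  if-sum false {n} t = ≈-sym (sum-replicate-zero n)

  module _ {m n} (h : Fin m → Fin n) where

    -- For `h` equal to `tail` or `head` this unfolds to `outflow` or `inflow`, so one proof serves
    -- both.
    flux : (Fin m → Carrier) → Fin n → Carrier
    flux f v = sum λ e → if does (h e ≟ v) then f e else 0#

    flux-cong : ∀ {f g} → (∀ e → f e ≈ g e) → ∀ v → flux f v ≈ flux g v
    flux-cong f≈g v = sum-cong-≋ λ e → if-cong (does (h e ≟ v)) (f≈g e)

    flux-0 : ∀ {f} → (∀ e → f e ≈ 0#) → ∀ v → flux f v ≈ 0#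
    flux-0 f≈0 v = sum-≈0 λ e → if-0 (does (h e ≟ v)) (f≈0 e)

    flux-∙ : ∀ f g v → flux (λ e → f e ∙ g e) v ≈ flux f v ∙ flux g v
    flux-∙ f g v = ≈-trans (sum-cong-≋ λ e → if-∙ (does (h e ≟ v)) (f e) (g e)) (sum-distrib-∙ {m} _ _)

    flux-⁻¹ : ∀ f v → flux (λ e → f e ⁻¹) v ≈ flux f v ⁻¹
    flux-⁻¹ f v = inverseʳ-unique _ _ (≈-trans (≈-sym (flux-∙ f _ v)) (flux-0 (λ e → inverseʳ (f e)) v))

    flux-single : ∀ e x v → flux (λ e′ → if does (e ≟ e′) then x else 0#) v ≈ (if does (h e ≟ v) then x else 0#)
    flux-single e x v = ≈-trans
      (sum-single _ e λ j e≢j → if-0 (does (h j ≟ v))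
        (≈-reflexive (cong (if_then x else 0#) (dec-false (e ≟ j) e≢j))))
      (if-cong (does (h e ≟ v)) (≈-reflexive (cong (if_then x else 0#) (dec-true (e ≟ e) refl))))

    -- Double counting: after exchanging the sums, an edge contributes only at the vertex `h e`.
    -- With `φ` a vertex class, this turns Kirchhoff's law into a balance across a cut.
    sum-flux : ∀ (φ : Fin n → Bool) f →
               sum (λ v → if φ v then flux f v else 0#) ≈ sum λ e → if φ (h e) then f e else 0#
    sum-flux φ f = begin
      sum (λ v → if φ v then flux f v else 0#)
        ≈⟨ (sum-cong-≋ λ v → if-sum (φ v) (λ e → if does (h e ≟ v) then f e else 0#)) ⟩
      sum (λ v → sum λ e → if φ v then (if does (h e ≟ v) then f e else 0#) else 0#)
        ≈⟨ ∑-comm {n} {m} _ ⟩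
      sum (λ e → sum λ v → if φ v then (if does (h e ≟ v) then f e else 0#) else 0#)
        ≈⟨ (sum-cong-≋ λ e → ≈-trans
             (sum-single _ (h e) λ v he≢v → if-0 (φ v) (≈-reflexive (cong (if_then f e else 0#) (dec-false (h e ≟ v) he≢v))))
             (if-cong (φ (h e)) (≈-reflexive (cong (if_then f e else 0#) (dec-true (h e ≟ h e) refl))))) ⟩
      sum (λ e → if φ (h e) then f e else 0#) ∎

module FlowCount {c ℓ} {G : Graph} (G′ : Orientation G) (A : FiniteAbelianGroup c ℓ) where

  open Graph G
  open Orientation G′
  open ListConnectivity ends
  open FiniteAbelianGroup A using (abelianGroup; finite; order; _≈?_)
  open AbelianGroup abelianGroup
    renaming (refl to ≈-refl; sym to ≈-sym; trans to ≈-trans; reflexive to ≈-reflexive; ε to 0#)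
  open AbelianGroupProperties abelianGroup using (∙-cancelʳ)
  open Flux abelianGroup
  module 𝔸 = Inverse (proj₂ finite)

  E-setoid : Setoid c ℓ
  E-setoid = Π-setoid λ (_ : Fin #E) → setoid

  E-finite : Finite E-setoid
  E-finite = Π-finite (λ (_ : Fin #E) → setoid) λ _ → finite

  -- The support is a list because both flows and components are followed while edges are added one
  -- at a time.
  FlowOn : List (Fin #E) → (Fin #E → Carrier) → Set ℓ
  FlowOn L f = Kirchhoff G′ A f × (∀ e → e ∉ L → f e ≈ 0#)

  Kirchhoff? : ∀ f → Dec (Kirchhoff G′ A f)
  Kirchhoff? f = all? λ v → outflow G′ A f v ≈? inflow G′ A f v

  FlowOn? : ∀ L f → Dec (FlowOn L f)
  FlowOn? L f = Kirchhoff? f ×-dec all? λ e → ¬? (_∈?_ _≟_ e L) →-dec (f e ≈? 0#)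

  Kirchhoff-resp : ∀ {f g} → (∀ e → f e ≈ g e) → Kirchhoff G′ A f → Kirchhoff G′ A g
  Kirchhoff-resp f≈g kf v = ≈-trans (≈-sym (flux-cong tail f≈g v)) (≈-trans (kf v) (flux-cong head f≈g v))

  Kirchhoff-∙ : ∀ {f g} → Kirchhoff G′ A f → Kirchhoff G′ A g → Kirchhoff G′ A (λ e → f e ∙ g e)
  Kirchhoff-∙ {f} {g} kf kg v = ≈-trans (flux-∙ tail f g v)
    (≈-trans (∙-cong (kf v) (kg v)) (≈-sym (flux-∙ head f g v)))

  Kirchhoff-⁻¹ : ∀ {f} → Kirchhoff G′ A f → Kirchhoff G′ A (λ e → f e ⁻¹)
  Kirchhoff-⁻¹ {f} kf v = ≈-trans (flux-⁻¹ tail f v) (≈-trans (⁻¹-cong (kf v)) (≈-sym (flux-⁻¹ head f v)))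

  FlowOn-resp : ∀ {L f g} → (∀ e → f e ≈ g e) → FlowOn L f → FlowOn L g
  FlowOn-resp f≈g (kf , sf) = Kirchhoff-resp f≈g kf , λ e e∉L → ≈-trans (≈-sym (f≈g e)) (sf e e∉L)

  -- For every x, an edge function supported on L that carries x from u to v.
  record Transport (L : List (Fin #E)) (u v : Fin #V) : Set (c ⊔ ℓ) where
    field
      value      : Carrier → Fin #E → Carrier
      value-cong : ∀ {x y} → x ≈ y → ∀ e → value x e ≈ value y e
      supported  : ∀ x e → e ∉ L → value x e ≈ 0#
      balance    : ∀ x w → outflow G′ A (value x) w ∙ (if does (v ≟ w) then x else 0#)
                         ≈ inflow G′ A (value x) w ∙ (if does (u ≟ w) then x else 0#)

  open Transport

  transport-mono : ∀ {L M u v} → (∀ {e} → e ∈ L → e ∈ M) → Transport L u v → Transport M u v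
  transport-mono L⊆M τ = record
    { value      = value τ
    ; value-cong = value-cong τ
    ; supported  = λ x e e∉M → supported τ x e (e∉M ∘ L⊆M)
    ; balance    = balance τ
    }

  transport-refl : ∀ {L u} → Transport L u u
  transport-refl = record
    { value      = λ _ _ → 0#
    ; value-cong = λ _ _ → ≈-refl
    ; supported  = λ _ _ _ → ≈-refl
    ; balance    = λ _ w → ∙-congʳ (≈-trans (flux-0 tail (λ _ → ≈-refl) w) (≈-sym (flux-0 head (λ _ → ≈-refl) w)))
    }

  transport-trans : ∀ {L u w v} → Transport L u w → Transport L w v → Transport L u v
  transport-trans σ τ = record
    { value      = λ x e → value σ x e ∙ value τ x e
    ; value-cong = λ x≈y e → ∙-cong (value-cong σ x≈y e) (value-cong τ x≈y e)
    ; supported  = λ x e e∉L → ≈-trans (∙-cong (supported σ x e e∉L) (supported τ x e e∉L)) (identityˡ 0#)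
    ; balance    = λ x w → ≈-trans (∙-congʳ (flux-∙ tail _ _ w))
        (≈-trans (∙-cancel-middle (balance σ x w) (balance τ x w)) (∙-congʳ (≈-sym (flux-∙ head _ _ w))))
    }

  -- Sending `x` backwards is sending its inverse forwards.
  transport-sym : ∀ {L u v} → Transport L u v → Transport L v u
  transport-sym {u = u} {v} τ = record
    { value      = λ x → value τ (x ⁻¹)
    ; value-cong = λ x≈y → value-cong τ (⁻¹-cong x≈y)
    ; supported  = λ x → supported τ (x ⁻¹)
    ; balance    = λ x w → ∙-swap-inverses (≈-trans (∙-congˡ (≈-sym (if-⁻¹ (does (v ≟ w)) x)))
        (≈-trans (balance τ (x ⁻¹) w) (∙-congˡ (if-⁻¹ (does (u ≟ w)) x))))
    }

  transport-arc : ∀ {L e} → e ∈ L → Transport L (tail e) (head e)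
  transport-arc {e = e} e∈L = record
    { value      = λ x e′ → if does (e ≟ e′) then x else 0#
    ; value-cong = λ x≈y e′ → if-cong (does (e ≟ e′)) x≈y
    ; supported  = λ x e′ e′∉L → ≈-reflexive (cong (if_then x else 0#) (dec-false (e ≟ e′) λ { refl → e′∉L e∈L }))
    ; balance    = λ x w → ≈-trans (∙-congʳ (flux-single tail e x w))
        (≈-trans (comm _ _) (∙-congʳ (≈-sym (flux-single head e x w))))
    }

  transport-edge : ∀ {L e} → e ∈ L → Transport L (proj₁ (ends e)) (proj₂ (ends e))
  transport-edge {L} {e} e∈L with arc-orients e
  ... | inj₁ eq = subst₂ (Transport L) (cong proj₁ eq) (cong proj₂ eq) (transport-arc e∈L)
  ... | inj₂ eq = transport-sym (subst₂ (Transport L) (cong proj₁ eq) (cong proj₂ eq) (transport-arc e∈L))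

  transport-path : ∀ {L u v} → EqClosure (AdjacentL L) u v → Transport L u v
  transport-path ε                         = transport-refl
  transport-path (fwd (e , e∈L , refl) ◅ p) = transport-trans (transport-edge e∈L) (transport-path p)
  transport-path (bwd (e , e∈L , refl) ◅ p) = transport-trans (transport-sym (transport-edge e∈L)) (transport-path p)

  -- When the two ends coincide, the extra terms in `balance` are equal and cancel, leaving
  -- Kirchhoff's law.
  transport-loop : ∀ {L u} (τ : Transport L u u) x → FlowOn L (value τ x)
  transport-loop τ x = (λ w → ∙-cancelʳ _ _ _ (balance τ x w)) , supported τ x

  arc-path : ∀ {L e} → EqClosure (AdjacentL L) (proj₁ (ends e)) (proj₂ (ends e)) →
             EqClosure (AdjacentL L) (head e) (tail e)
  arc-path {L} {e} p with arc-orients e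
  ... | inj₁ eq = subst₂ (EqClosure (AdjacentL L)) (sym (cong proj₂ eq)) (sym (cong proj₁ eq)) (Eq.symmetric _ p)
  ... | inj₂ eq = subst₂ (EqClosure (AdjacentL L)) (sym (cong proj₂ eq)) (sym (cong proj₁ eq)) p

  flowsOn : List (Fin #E) → Setoid (c ⊔ ℓ) ℓ
  flowsOn L = subsetoid E-setoid (FlowOn L)

  FlowOn-weaken : ∀ {L e f} → FlowOn L f → FlowOn (e ∷ L) f
  FlowOn-weaken (kf , sf) = kf , λ e′ e′∉ → sf e′ (e′∉ ∘ there)

  FlowOn-strengthen : ∀ {L e f} → FlowOn (e ∷ L) f → f e ≈ 0# → FlowOn L f
  FlowOn-strengthen {L} {e} {f} (kf , sf) fe≈0 = kf , support
    where
    support : ∀ e′ → e′ ∉ L → f e′ ≈ 0#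
    support e′ e′∉L with e ≟ e′
    ... | yes refl = fe≈0
    ... | no  e≢e′ = sf e′ λ { (here refl) → e≢e′ refl ; (there e′∈L) → e′∉L e′∈L }

  -- An edge closing a cycle: subtracting the circulation around that cycle
  -- makes the value on the edge zero.
  flowsOn-cycle : ∀ {L e n} → e ∉ L → EqClosure (AdjacentL L) (proj₁ (ends e)) (proj₂ (ends e)) →
                  HasCardinality (flowsOn L) n → HasCardinality (flowsOn (e ∷ L)) (order *ℕ n)
  flowsOn-cycle {L} {e} {n} e∉L p J = mkCardinality (flowsOn (e ∷ L)) to from to-cong to∘from from∘to
    where
    module J = Inverse J

    path : Transport L (head e) (tail e)
    path = transport-path (arc-path p)

    loop : Transport (e ∷ L) (tail e) (tail e)
    loop = transport-trans (transport-arc (here refl)) (transport-mono there path)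

    -- The return path stays in `L`, which omits `e`; hence the loop carries exactly `x` on `e`, and
    -- the value of a flow there determines the multiple to subtract.
    loop-e : ∀ x → value loop x e ≈ x
    loop-e x = ≈-trans (∙-cong (≈-reflexive (cong (if_then x else 0#) (dec-true (e ≟ e) refl)))
                               (supported path x e e∉L)) (identityʳ x)

    subtract : ∀ f → FlowOn (e ∷ L) f → FlowOn L (λ e′ → f e′ ∙ value loop (f e) e′ ⁻¹)
    subtract f (kf , sf) = FlowOn-strengthen
      ( Kirchhoff-∙ {f} kf (Kirchhoff-⁻¹ {value loop (f e)} (proj₁ (transport-loop loop (f e))))
      , λ e′ e′∉ → ≈-trans (∙-cong (sf e′ e′∉) (⁻¹-cong (supported loop (f e) e′ e′∉))) (inverseʳ 0#))
      (≈-trans (∙-congˡ (⁻¹-cong (loop-e (f e)))) (inverseʳ (f e)))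

    add : ∀ x g → FlowOn L g → FlowOn (e ∷ L) (λ e′ → g e′ ∙ value loop x e′)
    add x g (kg , sg) = Kirchhoff-∙ {g} kg (proj₁ (transport-loop loop x)) ,
      λ e′ e′∉ → ≈-trans (∙-cong (sg e′ (e′∉ ∘ there)) (supported loop x e′ e′∉)) (identityˡ 0#)

    to : Setoid.Carrier (flowsOn (e ∷ L)) → Fin (order *ℕ n)
    to (f , pf) = combine (𝔸.to (f e)) (J.to (_ , subtract f pf))

    from : Fin (order *ℕ n) → Setoid.Carrier (flowsOn (e ∷ L))
    from z = let x , y = remQuot {order} n z in _ , add (𝔸.from x) (proj₁ (J.from y)) (proj₂ (J.from y))

    to-cong : ∀ {f g} → Setoid._≈_ (flowsOn (e ∷ L)) f g → to f ≡ to g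
    to-cong f≈g = cong₂ combine (𝔸.to-cong (f≈g e))
      (J.to-cong λ e′ → ∙-cong (f≈g e′) (⁻¹-cong (value-cong loop (f≈g e) e′)))

    to∘from : ∀ z → to (from z) ≡ z
    to∘from z = trans (cong₂ combine (𝔸.inverseˡ at-e) (J.inverseˡ λ e′ →
        ≈-trans (∙-congˡ (⁻¹-cong (value-cong loop at-e e′)))
        (≈-trans (assoc _ _ _) (≈-trans (∙-congˡ (inverseʳ _)) (identityʳ _)))))
      (combine-remQuot {order} n z)
      where
      x = 𝔸.from (proj₁ (remQuot {order} n z))
      g = J.from (proj₂ (remQuot {order} n z))
      at-e : proj₁ g e ∙ value loop x e ≈ x
      at-e = ≈-trans (∙-cong (proj₂ (proj₂ g) e e∉L) (loop-e x)) (identityˡ x)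

    from∘to : ∀ f → Setoid._≈_ (flowsOn (e ∷ L)) (from (to f)) f
    from∘to (f , pf) e′ = ≈-trans
      (∙-cong (J.inverseʳ (cong proj₂ rq) e′) (value-cong loop (𝔸.inverseʳ (cong proj₁ rq)) e′))
      (≈-trans (assoc _ _ _) (≈-trans (∙-congˡ (inverseˡ _)) (identityʳ _)))
      where rq = remQuot-combine {order} {n} (𝔸.to (f e)) (J.to (_ , subtract f pf))

  -- The flow through the cut around the class of one end of a bridge is
  -- the value on the bridge.
  bridge-vanishes : ∀ {L e f} → ¬ EqClosure (AdjacentL L) (proj₁ (ends e)) (proj₂ (ends e)) →
                    FlowOn (e ∷ L) f → f e ≈ 0#
  bridge-vanishes {L} {e} {f} bridge (kf , sf) =
    ≈-trans (≈-sym (≈-reflexive (cong (if_then f e else 0#) (dec-true (cls (tail e) ≟ cls (tail e)) refl))))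
    (≈-trans (sum-cancel outₑ inₑ e elsewhere balanced)
             (≈-reflexive (cong (if_then f e else 0#) (dec-false (cls (head e) ≟ cls (tail e)) separated))))
    where
    open SetoidReasoning setoid
    open CommutativeMonoidSum commutativeMonoid using (sum; sum-cong-≋)
    module I = Inverse (proj₂ (componentsL-finite L))
    cls = I.to
    φ : Fin #V → Bool
    φ v = does (cls v ≟ cls (tail e))
    outₑ inₑ : Fin #E → Carrier
    outₑ e′ = if φ (tail e′) then f e′ else 0#
    inₑ  e′ = if φ (head e′) then f e′ else 0#
    balanced : sum outₑ ≈ sum inₑ
    balanced = begin
      sum outₑ ≈⟨ sum-flux tail φ f ⟨
      sum (λ v → if φ v then outflow G′ A f v else 0#) ≈⟨ (sum-cong-≋ λ v → if-cong (φ v) (kf v)) ⟩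
      sum (λ v → if φ v then inflow G′ A f v else 0#)  ≈⟨ sum-flux head φ f ⟩
      sum inₑ ∎
    same-class : ∀ {e′} → e′ ∈ L → cls (tail e′) ≡ cls (head e′)
    same-class {e′} e′∈L = sym (I.to-cong (arc-path (fwd (e′ , e′∈L , refl) ◅ ε)))
    -- Edges of `L` have both ends in one class, so they leave and enter the cut side alike; edges
    -- outside `e ∷ L` carry zero. Only `e` can cross with a nonzero value.
    elsewhere : ∀ e′ → e ≢ e′ → outₑ e′ ≈ inₑ e′
    elsewhere e′ e≢e′ with _∈?_ _≟_ e′ L
    ... | yes e′∈L = ≈-reflexive (cong (λ i → if does (i ≟ cls (tail e)) then f e′ else 0#) (same-class e′∈L))
    ... | no  e′∉L = ≈-trans (if-0 (φ (tail e′)) fe′≈0) (≈-sym (if-0 (φ (head e′)) fe′≈0))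
      where fe′≈0 = sf e′ λ { (here refl) → e≢e′ refl ; (there e′∈L) → e′∉L e′∈L }
    separated : cls (head e) ≢ cls (tail e)
    separated eq = bridge (ends-path (Eq.symmetric _ (I.inverseʳ eq) ◅◅ I.inverseʳ refl))
      where
      ends-path : EqClosure (AdjacentL L) (tail e) (head e) →
                  EqClosure (AdjacentL L) (proj₁ (ends e)) (proj₂ (ends e))
      ends-path p with arc-orients e
      ... | inj₁ eq = subst₂ (EqClosure (AdjacentL L)) (cong proj₁ eq) (cong proj₂ eq) p
      ... | inj₂ eq = subst₂ (EqClosure (AdjacentL L)) (cong proj₂ eq) (cong proj₁ eq) (Eq.symmetric _ p)

  flowsOn-bridge : ∀ {L e n} → ¬ EqClosure (AdjacentL L) (proj₁ (ends e)) (proj₂ (ends e)) →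
                   HasCardinality (flowsOn L) n → HasCardinality (flowsOn (e ∷ L)) n
  flowsOn-bridge {L} {e} bridge J = mkCardinality (flowsOn (e ∷ L))
    (λ { (f , pf) → J.to (f , FlowOn-strengthen pf (bridge-vanishes bridge pf)) })
    (λ j → proj₁ (J.from j) , FlowOn-weaken (proj₂ (J.from j)))
    (λ f≈g → J.to-cong f≈g)
    (λ j → J.inverseˡ λ _ → ≈-refl)
    (λ f → J.inverseʳ refl)
    where module J = Inverse J

  -- The exponent is tracked by an equation free of subtraction: a cycle edge raises both sides by
  -- one, while for a bridge the extra edge is offset by the lost component. Uniqueness keeps a
  -- repeated edge from passing as one that closes a cycle.
  flowsOn-cardinality : ∀ L → Unique L → ∃ λ r → r + #V ≡ length L + cL L × HasCardinality (flowsOn L) (order ^ℕ r)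
  flowsOn-cardinality [] _ = 0 , refl , mkCardinality (flowsOn [])
    (λ _ → zero) (λ _ → (λ _ → 0#) , kirchhoff-0 , λ _ _ → ≈-refl) (λ _ → refl)
    (λ { zero → refl ; (suc ()) }) (λ { (f , _ , sf) e → ≈-sym (sf e λ ()) })
    where
    kirchhoff-0 : Kirchhoff G′ A (λ _ → 0#)
    kirchhoff-0 w = ≈-trans (flux-0 tail (λ _ → ≈-refl) w) (≈-sym (flux-0 head (λ _ → ≈-refl) w))
  flowsOn-cardinality (e ∷ L) (e∉L ∷ uL) with flowsOn-cardinality L uL | step e L
  ... | r , eq , I | same p cL≡   = suc r , cong suc (trans eq (cong (λ n → length L + n) (sym cL≡))) ,
    flowsOn-cycle (λ e∈L → All.lookup e∉L e∈L refl) p I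
  ... | r , eq , I | merged ¬p cL≡ = r , trans eq (trans (cong (λ n → length L + n) (sym cL≡)) (ℕₚ.+-suc _ _)) ,
    flowsOn-bridge ¬p I

elements-unique : ∀ {m} (B : Subset m) → Unique (elements B)
elements-unique []            = []
elements-unique (inside  ∷ B) = All.tabulate (λ x 0≡ → 0∉ (subst (_∈ _) (sym 0≡) x)) ∷ Unique.map⁺ suc-injective (elements-unique B)
  where
  0∉ : zero ∉ map suc (elements B)
  0∉ x with _ , _ , () ← ∈-map⁻ suc x
elements-unique (outside ∷ B) = Unique.map⁺ suc-injective (elements-unique B)

-- Coupled flows

open CommutativeSemigroupProperties ℤₚ.*-commutativeSemigroup using () renaming (interchange to *-interchange)

∏-const : ∀ k c → (∏ {k} λ _ → c) ≡ c ^ k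
∏-const zero    c = refl
∏-const (suc k) c = cong (c *_) (∏-const k c)

^-distribʳ-* : ∀ n x y → (x * y) ^ n ≡ x ^ n * y ^ n
^-distribʳ-* zero    x y = refl
^-distribʳ-* (suc n) x y = trans (cong ((x * y) *_) (^-distribʳ-* n x y)) (*-interchange x y (x ^ n) (y ^ n))

pos-^ : ∀ a n → + (a ^ℕ n) ≡ (+ a) ^ n
pos-^ a zero    = refl
pos-^ a (suc n) = trans (ℤₚ.pos-* a (a ^ℕ n)) (cong (+ a *_) (pos-^ a n))

∑-∏-scale : ∀ {a} {X : Set a} {k} n (xs : List X) (φ : X → Fin k → ℤ) →
            (∑ xs λ x → ∏ λ i → -1ℤ ^ n * φ x i) ≡ -1ℤ ^ (k *ℕ n) * ∑ xs λ x → ∏ (φ x)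
∑-∏-scale {k = k} n xs φ = begin
  (∑ xs λ x → ∏ λ i → -1ℤ ^ n * φ x i)            ≡⟨ (∑-cong xs λ x → ℤ∏.∑-distrib-+ (λ _ → -1ℤ ^ n) (φ x)) ⟩
  (∑ xs λ x → (∏ {k} λ _ → -1ℤ ^ n) * ∏ (φ x))    ≡⟨ *-distribˡ-∑ (∏ {k} λ _ → -1ℤ ^ n) xs (λ x → ∏ (φ x)) ⟨
  (∏ {k} λ _ → -1ℤ ^ n) * (∑ xs λ x → ∏ (φ x))    ≡⟨ cong (_* (∑ xs λ x → ∏ (φ x))) (begin
    (∏ {k} λ _ → -1ℤ ^ n) ≡⟨ ∏-const k (-1ℤ ^ n) ⟩
    (-1ℤ ^ n) ^ k         ≡⟨ ℤₚ.^-*-assoc -1ℤ n k ⟩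
    -1ℤ ^ (n *ℕ k)        ≡⟨ cong (-1ℤ ^_) (ℕₚ.*-comm n k) ⟩
    -1ℤ ^ (k *ℕ n)        ∎) ⟩
  -1ℤ ^ (k *ℕ n) * (∑ xs λ x → ∏ (φ x))           ∎
  where open ≡-Reasoning

∏-sign : ∀ {m} (B : Subset m) → (∏ λ e → sign (lookup B e)) ≡ -1ℤ ^ ∣ B ∣
∏-sign []            = refl
∏-sign (inside  ∷ B) = cong (-1ℤ *_) (∏-sign B)
∏-sign (outside ∷ B) = trans (ℤₚ.*-identityˡ _) (∏-sign B)

not-does-≤⁺ : ∀ {p} {P : Set p} (P? : Dec P) {b} → (b ≢ inside → P) → not (does P?) ≤ᵇ b
not-does-≤⁺ (yes _) h         = ≤-minimum _
not-does-≤⁺ (no _)  {true}  h = b≤b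
not-does-≤⁺ (no ¬p) {false} h = contradiction (h λ ()) ¬p

not-does-≤⁻ : ∀ {p} {P : Set p} (P? : Dec P) {b} → not (does P?) ≤ᵇ b → b ≢ inside → P
not-does-≤⁻ (yes p) _   _ = p
not-does-≤⁻ (no _)  b≤b h = contradiction refl h

module _ {c ℓ} {G : Graph} (G′ : Orientation G) (A : FiniteAbelianGroup c ℓ) where

  open Graph G
  open ListConnectivity ends
  open FiniteAbelianGroup A using (Carrier; order; _≈_; _≈?_; 0#)
  open FlowCount G′ A

  nonzeroAt : (Fin #E → Carrier) → Fin #E → Bool
  nonzeroAt g e = not (does (g e ≈? 0#))

  -- Here `r` is the cyclomatic number `|B| - |V| + c(B)`. Since `c(B)` is at most `|V|`, the
  -- vertices split exactly into components plus rank, despite truncated subtraction.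
  cyclomatic : ∀ B r → r + #V ≡ ∣ B ∣ + #components G B → r ≡ ∣ B ∣ ∸ graphRk G B
  cyclomatic B r eq = begin
    r                               ≡⟨ ℕₚ.m+n∸n≡m r #V ⟨
    (r + #V) ∸ #V                   ≡⟨ cong (_∸ #V) (trans eq (ℕₚ.+-comm ∣ B ∣ _)) ⟩
    (#components G B + ∣ B ∣) ∸ #V  ≡⟨ cong ((#components G B + ∣ B ∣) ∸_) (ℕₚ.m+[n∸m]≡n (cL≤n (elements B))) ⟨
    (#components G B + ∣ B ∣) ∸ (#components G B + graphRk G B) ≡⟨ ℕₚ.[m+n]∸[m+o]≡n∸o (#components G B) _ _ ⟩
    ∣ B ∣ ∸ graphRk G B             ∎
    where open ≡-Reasoning

  -- Two counts of one setoid meet: filtering all edge functions yields the sum of indicators, and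
  -- adding edges one by one yields the power of the order.
  flows-supported : ∀ B → sumOver E-finite (ind ∘ FlowOn? (elements B)) ≡ (+ order) ^ (∣ B ∣ ∸ graphRk G B)
  flows-supported B with flowsOn-cardinality (elements B) (elements-unique B)
  ... | r , eq , I = begin
    sumOver E-finite (ind ∘ FlowOn? (elements B))
      ≡⟨ card-subsetoid-finite (FlowOn (elements B)) (FlowOn? (elements B)) FlowOn-resp E-finite ⟨
    + card (subsetoid-finite (FlowOn (elements B)) (FlowOn? (elements B)) FlowOn-resp E-finite)
      ≡⟨ cong +_ (card-unique (proj₂ (subsetoid-finite (FlowOn (elements B)) (FlowOn? (elements B)) FlowOn-resp E-finite)) I) ⟩
    + (order ^ℕ r)                       ≡⟨ pos-^ order r ⟩
    (+ order) ^ r                        ≡⟨ cong ((+ order) ^_) (cyclomatic B r (trans eq (cong (_+ #components G B) (length-elements B)))) ⟩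
    (+ order) ^ (∣ B ∣ ∸ graphRk G B)    ∎
    where open ≡-Reasoning

  supported⇒≤ : ∀ B g → FlowOn (elements B) g → ∀ e → nonzeroAt g e ≤ᵇ lookup B e
  supported⇒≤ B g (_ , sg) e = not-does-≤⁺ (g e ≈? 0#) λ e∉B → sg e λ x → e∉B ([]=⇒lookup (∈-elements⁻ {p = B} x))

  ≤⇒supported : ∀ B g → (∀ e → nonzeroAt g e ≤ᵇ lookup B e) → ∀ e → e ∉ elements B → g e ≈ 0#
  ≤⇒supported B g g≤B e e∉B = not-does-≤⁻ (g e ≈? 0#) (g≤B e) λ eq → e∉B (∈-elements⁺ (lookup⇒[]= e B eq))

  -- The order indicators multiply to the condition that `g` vanishes off `B`, and the signs depend
  -- on `B` alone, so they leave the sum over `g`.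
  weighted-flows : ∀ B →
    sumOver E-finite (λ g → ind (Kirchhoff? g) * ∏ λ e → weight (nonzeroAt g e) (lookup B e)) ≡
    -1ℤ ^ #E * (-1ℤ ^ ∣ B ∣ * (+ order) ^ (∣ B ∣ ∸ graphRk G B))
  weighted-flows B = begin
    sumOver E-finite (λ g → ind (Kirchhoff? g) * ∏ λ e → weight (nonzeroAt g e) (lookup B e))
      ≡⟨ (ℤΣ.sum-cong-≗ {card E-finite} λ j → pointwise (Inverse.from (proj₂ E-finite) j)) ⟩
    sumOver E-finite (λ g → signs * ind (FlowOn? (elements B) g))
      ≡⟨ ℤΣ.*-distribˡ-sum {card E-finite} signs _ ⟨
    signs * sumOver E-finite (ind ∘ FlowOn? (elements B))
      ≡⟨ cong (signs *_) (flows-supported B) ⟩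
    signs * (+ order) ^ (∣ B ∣ ∸ graphRk G B)
      ≡⟨ ℤₚ.*-assoc (-1ℤ ^ #E) _ _ ⟩
    -1ℤ ^ #E * (-1ℤ ^ ∣ B ∣ * (+ order) ^ (∣ B ∣ ∸ graphRk G B)) ∎
    where
    open ≡-Reasoning
    signs = -1ℤ ^ #E * -1ℤ ^ ∣ B ∣
    signs≡ : (∏ λ e → -1ℤ * sign (lookup B e)) ≡ signs
    signs≡ = trans (ℤ∏.∑-distrib-+ {#E} (λ _ → -1ℤ) (λ e → sign (lookup B e))) (cong₂ _*_ (∏-const #E -1ℤ) (∏-sign B))
    pointwise : ∀ g → ind (Kirchhoff? g) * (∏ λ e → weight (nonzeroAt g e) (lookup B e)) ≡ signs * ind (FlowOn? (elements B) g)
    pointwise g = begin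
      ind (Kirchhoff? g) * (∏ λ e → weight (nonzeroAt g e) (lookup B e))
        ≡⟨ cong (ind (Kirchhoff? g) *_) (ℤ∏.∑-distrib-+ {#E} (ind ∘ g≤?B) _) ⟩
      ind (Kirchhoff? g) * ((∏ λ e → ind (g≤?B e)) * (∏ λ e → -1ℤ * sign (lookup B e)))
        ≡⟨ cong₂ (λ x y → ind (Kirchhoff? g) * (x * y)) (sym (ind-∀ g≤?B (all? g≤?B))) signs≡ ⟩
      ind (Kirchhoff? g) * (ind (all? g≤?B) * signs)
        ≡⟨ ℤₚ.*-assoc (ind (Kirchhoff? g)) _ _ ⟨
      (ind (Kirchhoff? g) * ind (all? g≤?B)) * signs
        ≡⟨ cong (_* signs) (ind-× (Kirchhoff? g) (all? g≤?B)) ⟨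
      ind (Kirchhoff? g ×-dec all? g≤?B) * signs
        ≡⟨ cong (_* signs) (ind-⇔ (λ (kg , g≤B) → kg , ≤⇒supported B g g≤B) (λ p → proj₁ p , supported⇒≤ B g p)
             (Kirchhoff? g ×-dec all? g≤?B) (FlowOn? (elements B) g)) ⟩
      ind (FlowOn? (elements B) g) * signs
        ≡⟨ ℤₚ.*-comm _ signs ⟩
      signs * ind (FlowOn? (elements B) g) ∎
      where
      g≤?B : ∀ e → Dec (nonzeroAt g e ≤ᵇ lookup B e)
      g≤?B e = nonzeroAt g e ≤ᵇ? lookup B e

module _ {c ℓ} {G : Graph} (G′ : Orientation G) {k : ℕ} (A : Fin k → FiniteAbelianGroup c ℓ) where

  open Graph G
  private
    module 𝔽 i = FiniteAbelianGroup (A i)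
    module 𝔼 i = FlowCount G′ (A i)

  tuple-finite : Finite (tupleSetoid G′ A)
  tuple-finite = Π-finite _ 𝔼.E-finite

  chain-weight : Tuple G′ A → Vec (Subset #E) k → Fin k → Fin #E → ℤ
  chain-weight f B i e = weight (nonzeroAt G′ (A i) (f i) e) (lookup (lookup B i) e)

  -- Decouples the groups: in each summand the factor at `i` depends on `f` only through `f i`.
  ind-coupled : ∀ f → ind (IsCoupledFlow? G′ A f) ≡
    ∑ (chains k #E) λ B → ∏ λ i → ind (𝔼.Kirchhoff? i (f i)) * ∏ (chain-weight f B i)
  ind-coupled f = begin
    ind (IsCoupledFlow? G′ A f)
      ≡⟨ ind-⇔ (λ (kf , h) → kf , λ e → coupled⇒firstOdd (vanishes? e) (h e))
               (λ (kf , h) → kf , λ e → firstOdd⇒coupled (vanishes? e) (h e))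
               (IsCoupledFlow? G′ A f) (all? kirchhoff? ×-dec all? odd?) ⟩
    ind (all? kirchhoff? ×-dec all? odd?)
      ≡⟨ ind-× (all? kirchhoff?) (all? odd?) ⟩
    ind (all? kirchhoff?) * ind (all? odd?)
      ≡⟨ cong₂ _*_ (ind-∀ kirchhoff? (all? kirchhoff?)) (ind-∀ odd? (all? odd?)) ⟩
    κ * (∏ λ e → ind (odd? e))
      ≡⟨ cong (κ *_) (ℤ∏.sum-cong-≗ λ e → ∑-monotone (nonzero (vanishes? e))) ⟨
    κ * (∏ λ e → ∑ (vectors bits k) (ψ e))
      ≡⟨ cong (κ *_) (∏-∑ k ψ) ⟩
    κ * (∑ (vectors (subsets #E) k) λ B → ∏ λ e → ψ e (column e B))
      ≡⟨ cong (κ *_) (∑-cong (vectors (subsets #E) k) by-columns) ⟩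
    κ * (∑ (vectors (subsets #E) k) λ B → ind (linked? _⊆?_ B) * ∏ λ i → ∏ (chain-weight f B i))
      ≡⟨ cong (κ *_) (∑-filter (linked? _⊆?_) (vectors (subsets #E) k) _) ⟨
    κ * (∑ (chains k #E) λ B → ∏ λ i → ∏ (chain-weight f B i))
      ≡⟨ *-distribˡ-∑ κ (chains k #E) _ ⟩
    (∑ (chains k #E) λ B → κ * ∏ λ i → ∏ (chain-weight f B i))
      -- Each Kirchhoff indicator joins the factor of its own index, giving the form needed to split
      -- the sum over tuples.
      ≡⟨ (∑-cong (chains k #E) λ B → ℤ∏.∑-distrib-+ (ind ∘ kirchhoff?) (λ i → ∏ (chain-weight f B i))) ⟨
    (∑ (chains k #E) λ B → ∏ λ i → ind (𝔼.Kirchhoff? i (f i)) * ∏ (chain-weight f B i)) ∎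
    where
    open ≡-Reasoning
    vanishes? : ∀ e i → Dec (Vanishes G′ A f e i)
    vanishes? e i = 𝔽._≈?_ i (f i e) (𝔽.0# i)
    kirchhoff? : ∀ i → Dec (Kirchhoff G′ (A i) (f i))
    kirchhoff? i = 𝔼.Kirchhoff? i (f i)
    odd? : ∀ e → Dec (T (firstOdd (nonzero (vanishes? e))))
    odd? e = T? _
    κ = ∏ (ind ∘ kirchhoff?)
    ψ : Fin #E → Vec Bool k → ℤ
    ψ e b = ind (monotone b) * ∏ λ i → weight (nonzero (vanishes? e) i) (lookup b i)
    by-columns : ∀ B → (∏ λ e → ψ e (column e B)) ≡ ind (linked? _⊆?_ B) * ∏ λ i → ∏ (chain-weight f B i)
    by-columns B = begin
      (∏ λ e → ψ e (column e B))
        ≡⟨ ℤ∏.∑-distrib-+ {#E} (λ e → ind (monotone (column e B))) _ ⟩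
      (∏ λ e → ind (monotone (column e B))) * (∏ λ e → ∏ λ i → weight (nonzero (vanishes? e) i) (lookup (column e B) i))
        ≡⟨ cong₂ _*_
             (trans (sym (ind-∀ (λ e → monotone (column e B)) (all? λ e → monotone (column e B))))
                    (ind-⇔ columns⇒chain chain⇒columns (all? λ e → monotone (column e B)) (linked? _⊆?_ B)))
             (ℤ∏.sum-cong-≗ {#E} λ e → ℤ∏.sum-cong-≗ {k} λ i →
                cong (weight (nonzero (vanishes? e) i)) (lookup-map i (λ S → lookup S e) B)) ⟩
      ind (linked? _⊆?_ B) * (∏ λ e → ∏ λ i → chain-weight f B i e)
        ≡⟨ cong (ind (linked? _⊆?_ B) *_) (ℤ∏.∑-comm {#E} {k} λ e i → chain-weight f B i e) ⟩
      ind (linked? _⊆?_ B) * (∏ λ i → ∏ (chain-weight f B i)) ∎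

  Flow≡∑ : + Flow G′ A ≡ ∑ (chains k #E) λ B → ∏ λ i →
    -1ℤ ^ #E * (-1ℤ ^ ∣ lookup B i ∣ * (+ 𝔽.order i) ^ (∣ lookup B i ∣ ∸ graphRk G (lookup B i)))
  Flow≡∑ = begin
    + Flow G′ A
      ≡⟨ card-subsetoid-finite (IsCoupledFlow G′ A) (IsCoupledFlow? G′ A) (IsCoupledFlow-resp G′ A) tuple-finite ⟩
    sumOver tuple-finite (ind ∘ IsCoupledFlow? G′ A)
      ≡⟨ (ℤΣ.sum-cong-≗ {card tuple-finite} λ j → ind-coupled (Inverse.from (proj₂ tuple-finite) j)) ⟩
    sumOver tuple-finite (λ f → ∑ (chains k #E) λ B → ∏ λ i → term B i (f i))
      ≡⟨ sum-∑-swap {n = card tuple-finite} (chains k #E) _ ⟩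
    (∑ (chains k #E) λ B → sumOver tuple-finite λ f → ∏ λ i → term B i (f i))
      ≡⟨ (∑-cong (chains k #E) λ B → sumOver-Π _ 𝔼.E-finite (term B)) ⟩
    (∑ (chains k #E) λ B → ∏ λ i → sumOver (𝔼.E-finite i) (term B i))
      ≡⟨ (∑-cong (chains k #E) λ B → ℤ∏.sum-cong-≗ λ i → weighted-flows G′ (A i) (lookup B i)) ⟩
    (∑ (chains k #E) λ B → ∏ λ i →
      -1ℤ ^ #E * (-1ℤ ^ ∣ lookup B i ∣ * (+ 𝔽.order i) ^ (∣ lookup B i ∣ ∸ graphRk G (lookup B i)))) ∎
    where
    open ≡-Reasoning
    term : Vec (Subset #E) k → ∀ i → (Fin #E → 𝔽.Carrier i) → ℤ
    term B i g = ind (𝔼.Kirchhoff? i g) * ∏ λ e → weight (nonzeroAt G′ (A i) g e) (lookup (lookup B i) e)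

-- Comparison with the chain Tutte polynomial

-1-square : ∀ n → -1ℤ ^ n * -1ℤ ^ n ≡ 1ℤ
-1-square n = trans (sym (^-distribʳ-* n -1ℤ -1ℤ)) (ℤₚ.^-zeroˡ n)

-- Modulo 2, `rank ∸ rk B` plus `∣ B ∣ ∸ rk B` is `rank + ∣ B ∣`, because `rk B` is counted twice.
-- Only boundedness and monotonicity of the rank enter, to make both subtractions exact.
Tutte-term : ∀ {m} (M : Matroid m) t (B : Subset m) → let open Matroid M in
  -1ℤ ^ m * (-1ℤ ^ ∣ B ∣ * (+ t) ^ (∣ B ∣ ∸ rk B)) ≡
  -1ℤ ^ (m + rank) * ((0ℤ - 1ℤ) ^ (rank ∸ rk B) * ((1ℤ - + t) - 1ℤ) ^ (∣ B ∣ ∸ rk B))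
Tutte-term {m} M t B = begin
  -1ℤ ^ m * (-1ℤ ^ ∣ B ∣ * (+ t) ^ q)
    ≡⟨ cong (λ n → -1ℤ ^ m * (-1ℤ ^ n * (+ t) ^ q)) (sym (ℕₚ.m∸n+n≡m (rk-bounded B))) ⟩
  -1ℤ ^ m * (-1ℤ ^ (q + rk B) * (+ t) ^ q)
    ≡⟨ cong (λ z → -1ℤ ^ m * (z * (+ t) ^ q)) (ℤₚ.^-distribˡ-+-* -1ℤ q (rk B)) ⟩
  -1ℤ ^ m * ((-1ℤ ^ q * -1ℤ ^ rk B) * (+ t) ^ q)
    ≡⟨ ℤₚ.*-identityˡ _ ⟨
  1ℤ * (-1ℤ ^ m * ((-1ℤ ^ q * -1ℤ ^ rk B) * (+ t) ^ q))
    -- A square equal to 1 is inserted: one copy of `-1ℤ ^ d` completes `-1ℤ ^ rk B` to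
    -- `-1ℤ ^ rank`, the other becomes the power of `x - 1` at `x = 0`.
    ≡⟨ cong (_* (-1ℤ ^ m * ((-1ℤ ^ q * -1ℤ ^ rk B) * (+ t) ^ q))) (-1-square d) ⟨
  (-1ℤ ^ d * -1ℤ ^ d) * (-1ℤ ^ m * ((-1ℤ ^ q * -1ℤ ^ rk B) * (+ t) ^ q))
    ≡⟨ rearrange (-1ℤ ^ d) (-1ℤ ^ m) (-1ℤ ^ q) (-1ℤ ^ rk B) ((+ t) ^ q) ⟩
  (-1ℤ ^ m * (-1ℤ ^ d * -1ℤ ^ rk B)) * (-1ℤ ^ d * (-1ℤ ^ q * (+ t) ^ q))
    ≡⟨ cong₂ (λ y z → (-1ℤ ^ m * y) * (-1ℤ ^ d * z)) (ℤₚ.^-distribˡ-+-* -1ℤ d (rk B)) (^-distribʳ-* q -1ℤ (+ t)) ⟨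
  (-1ℤ ^ m * -1ℤ ^ (d + rk B)) * (-1ℤ ^ d * (-1ℤ * + t) ^ q)
    ≡⟨ cong₂ (λ n z → (-1ℤ ^ m * -1ℤ ^ n) * (-1ℤ ^ d * z ^ q)) (ℕₚ.m∸n+n≡m (rk-monotone ⊆⊤)) (negate (+ t)) ⟩
  (-1ℤ ^ m * -1ℤ ^ rank) * (-1ℤ ^ d * ((1ℤ - + t) - 1ℤ) ^ q)
    ≡⟨ cong (_* (-1ℤ ^ d * ((1ℤ - + t) - 1ℤ) ^ q)) (ℤₚ.^-distribˡ-+-* -1ℤ m rank) ⟨
  -1ℤ ^ (m + rank) * (-1ℤ ^ d * ((1ℤ - + t) - 1ℤ) ^ q) ∎
  where
  open ≡-Reasoning
  open Matroid M
  q = ∣ B ∣ ∸ rk B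
  d = rank ∸ rk B
  rearrange : ∀ D M Q R T → (D * D) * (M * ((Q * R) * T)) ≡ (M * (D * R)) * (D * (Q * T))
  rearrange = solve-∀
  negate : ∀ x → -1ℤ * x ≡ (1ℤ - x) - 1ℤ
  negate = solve-∀

theorem1p12 : ∀ {c ℓ} (G : Graph) (G′ : Orientation G) (k : ℕ) → 1 ≤ k →
    (A : Fin k → FiniteAbelianGroup c ℓ) (t : Fin k → ℕ) →
    (∀ i → FiniteAbelianGroup.order (A i) ≡ t i) →
    let open Graph G
        chainSum = ∑ (chains k #E) λ B → ∏ λ i →
          -1ℤ ^ ∣ lookup B i ∣ * (+ t i) ^ (∣ lookup B i ∣ ∸ graphRk G (lookup B i))
        tutte = chainTutte (graphicMatroid G) k (λ _ → 0ℤ) (λ i → 1ℤ - + t i)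
    in (+ Flow G′ A ≡ -1ℤ ^ (k *ℕ #E) * chainSum)
       × (-1ℤ ^ (k *ℕ #E) * chainSum ≡ -1ℤ ^ (k *ℕ (#E + graphRank G)) * tutte)
theorem1p12 G G′ k _ A t order≡t = trans Flow≡∑-t (∑-∏-scale #E (chains k #E) summand) , (begin
    -1ℤ ^ (k *ℕ #E) * (∑ (chains k #E) λ B → ∏ (summand B))
      ≡⟨ ∑-∏-scale #E (chains k #E) summand ⟨
    (∑ (chains k #E) λ B → ∏ λ i → -1ℤ ^ #E * summand B i)
      -- With the sign distributed over the `k` factors, the two sides agree for each chain and each
      -- index.
      ≡⟨ (∑-cong (chains k #E) λ B → ℤ∏.sum-cong-≗ λ i → Tutte-term (graphicMatroid G) (t i) (lookup B i)) ⟩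
    (∑ (chains k #E) λ B → ∏ λ i → -1ℤ ^ (#E + graphRank G) * tutteSummand B i)
      ≡⟨ ∑-∏-scale (#E + graphRank G) (chains k #E) tutteSummand ⟩
    -1ℤ ^ (k *ℕ (#E + graphRank G)) * (∑ (chains k #E) λ B → ∏ (tutteSummand B)) ∎)
  where
  open Graph G
  open ≡-Reasoning
  summand tutteSummand : Vec (Subset #E) k → Fin k → ℤ
  summand B i = -1ℤ ^ ∣ lookup B i ∣ * (+ t i) ^ (∣ lookup B i ∣ ∸ graphRk G (lookup B i))
  tutteSummand B i = (0ℤ - 1ℤ) ^ (graphRank G ∸ graphRk G (lookup B i))
                     * ((1ℤ - + t i) - 1ℤ) ^ (∣ lookup B i ∣ ∸ graphRk G (lookup B i))
  Flow≡∑-t : + Flow G′ A ≡ ∑ (chains k #E) λ B → ∏ λ i → -1ℤ ^ #E * summand B i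
  Flow≡∑-t = trans (Flow≡∑ G′ A) (∑-cong (chains k #E) λ B → ℤ∏.sum-cong-≗ λ i →
    cong (λ n → -1ℤ ^ #E * (-1ℤ ^ ∣ lookup B i ∣ * (+ n) ^ (∣ lookup B i ∣ ∸ graphRk G (lookup B i)))) (order≡t i))
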